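{- There exists a family of $\Pi$-maps $M(G_i)$, $i\in\{1,2,3,\dots\}$, where $G_i$ is a connected simple cubic graph of girth 4 and genus $i$, with ETGCs $\mu'=\mu'(G_i)$ and associated PFCs $\mu=\mu(M(G_i))$, such that: each $M(G_i)$ is obtained by identifying opposite sides of a $(2i+1)$-cutout $X_i$; $M(G_i)$ has three $(8i+4)$-faces $F^i_0,F^i_1,F^i_2$ and $6i+3$ 4-faces; of these $6i+3$ 4-faces, $4i+2$ are each adjacent to each of the three $(8i+4)$-faces, while each of the remaining $2i+1$ 4-faces is adjacent on a pair of opposite edges to $F^i_1$ and $F^i_2$ and on the other pair of opposite edges to two of the first $4i+2$ 4-faces.
   Context: Write $[3]_0=\{0,1,2,3\}$. For a connected simple cubic graph $G$ of girth 4: a set $S_0\subseteq V(G)$ is an efficient dominating set (EDS) if $|N_G[v]\cap S_0|=1$ for every $v\in V(G)$. A total coloring colors vertices and edges so that no two incident or adjacent elements get the same color. An efficient total coloring (ETC) of $G$ is a total coloring $\mu:V(G)\cup E(G)\to[3]_0$ such that for each vertex $v$ the restriction of $\mu$ to $N_G[v]$ is a bijection onto $[3]_0$, and the four vertex color classes partition $V(G)$ into EDSs. An ETGC is an ETC in which every 4-cycle of $G$ has each of the four colors exactly once on its vertices and exactly once on its edges. The genus of a graph is the least $g$ such that it embeds in the closed orientable surface of genus $g$. A map $M(G)$ is an embedding of $G$ in a connected closed orientable surface $S$ of genus equal to the genus of $G$ such that the components of $S\setminus G$ are open disks; closures of these disks are the faces, and a belt is a face boundary cycle (an $\ell$-belt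 if it has length $\ell$, its face being an $\ell$-face). Two faces are adjacent if they share an edge. A vertex of $G$ in no 4-cycle of $G$ is a Y-vertex; an edge with both ends Y-vertices is a Y-edge. A $2\ell$-belt with consecutive edges $(e_1,\dots,e_{2\ell})$ is a Y-belt if its Y-edges, if any, occur only in opposite pairs $\{e_h,e_{h+\ell}\}$, $1\le h\le\ell$. $M(G)$ is a Y-map if all belts have even length and are Y-belts. A $\Pi$-map is a Y-map $M(G)$ for which $V(G)$ admits a partition into four EDSs, labelled $0,1,2,3$, such that the cyclic sequence of vertex colors of each $\ell$-belt has the form $(a,b,c,d)^{\ell/4}$ with $\{a,b,c,d\}=[3]_0$. An ETGC is periodic if for each belt, traversed in one of its two directions, the alternating cyclic sequence of colors (vertex, edge, vertex, edge, ...) is a concatenation of copies of $a,b,c,a,d,c,b,d$ for some $\{a,b,c,d\}=[3]_0$ (odd positions vertex colors, even positions edge colors). Given a periodic ETGC $\mu'$ of a $\Pi$-map $M(G)$, its associated PFC $\mu$ assigns to the face with belt $B$ the permutation $\mu(B)=abc$ of $\{1,2,3\}$, where $0,a,b,c$ are the $\mu'$-colors of four consecutive vertices of $B$ in clockwise order starting at a vertex of color $0$; adjacent faces receive distinct permutations. A $2n$-zonogon is a centrally symmetric convex polygon in $\mathbb{R}^2$ with $2n$ sides $(L_1,\dots,L_n,L_1^{ -1},\dots,L_n^{ -1})$, where opposite sides $L_j$, $L_j^{ -1}$ are parallel, of equal length and oppositely oriented. Gluing each $L_j$ with $L_j^{ -1}$ gives a closed orientable surface of genus $\lfloor n/2\rfloor$.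 An $n$-cutout of a map $M(G)$ of genus $\lfloor n/2\rfloor$ is a $2n$-zonogon (with a drawing in it) from which $M(G)$ is recovered as the quotient by these side identifications. -}

module Defs where

open import Level using (0ℓ)
open import Data.Nat using (ℕ; zero; suc; _+_; _*_; _≤_; _<_; ⌊_/2⌋)
open import Data.Nat.Divisibility using (_∣_)
open import Data.Nat.DivMod using (_mod_)
open import Data.Nat.GeneralisedArithmetic using (iterate)
open import Data.Fin as Fin using (Fin; zero; suc; toℕ; splitAt; join)
open import Data.Fin.Patterns using (0F; 1F; 2F; 3F)
open import Data.Fin.Permutation using (Permutation′; _⟨$⟩ʳ_; _≈_)
open import Data.Product using (Σ; ∃; _×_; _,_)
open import Data.Sum as Sum using (_⊎_; inj₁; inj₂)
open import Data.Vec using (Vec; []; _∷_; lookup)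
open import Function using (_∘_; Injective; Bijective; _⇔_)
open import Relation.Binary using (Rel; Decidable; Symmetric; Irreflexive)
open import Relation.Binary.Construct.Closure.ReflexiveTransitive using (Star)
open import Relation.Binary.PropositionalEquality using (_≡_; _≢_)
open import Relation.Nullary using (¬_)
open import Relation.Unary using (Pred; _∩_)

Enumerates : {A : Set} → Pred A 0ℓ → {k : ℕ} → (Fin k → A) → Set
Enumerates P e = Injective _≡_ _≡_ e × (∀ x → P x ⇔ ∃ λ j → e j ≡ x)

HasSize : {A : Set} → Pred A 0ℓ → ℕ → Set
HasSize {A} P k = Σ (Fin k → A) (Enumerates P)

-- The orbits of f, labelled by Fin k.  On a finite A, `same` forces f to be
-- a permutation, since it makes forward reachability symmetric.
record Orbits {A : Set} (f : A → A) (k : ℕ) : Set where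
  field
    orbit : A → Fin k
    onto  : ∀ c → ∃ λ x → orbit x ≡ c
    same  : ∀ x y → orbit x ≡ orbit y ⇔ ∃ λ m → iterate f x m ≡ y

-- A connected combinatorial map of Euler genus g on a nonempty set D of
-- darts: the orbits of the rotation σ are the vertices, those of the
-- involution α the edges, those of σ ∘ α the faces, and V − E + F = 2 − 2g.
record OfGenus {D : Set} (σ α : D → D) (g : ℕ) : Set where
  field
    #vertices #edges #faces : ℕ
    vertices  : Orbits σ #vertices
    edges     : Orbits α #edges
    faces     : Orbits (σ ∘ α) #faces
    connected : ∀ x y → Star (λ a b → b ≡ σ a ⊎ b ≡ α a) x y
    euler     : #vertices + #faces + 2 * g ≡ #edges + 2

record Graph (n : ℕ) : Set₁ where
  infix 4 _~_ _~?_
  field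
    _~_      : Rel (Fin n) 0ℓ
    _~?_     : Decidable _~_
    ~-sym    : Symmetric _~_
    ~-irrefl : Irreflexive _≡_ _~_

module _ {n : ℕ} (G : Graph n) where
  open Graph G

  IsConnected : Set
  IsConnected = ∀ u v → Star _~_ u v

  IsCubic : Set
  IsCubic = ∀ v → HasSize (v ~_) 3

  -- A k-cycle, as a k-periodic sequence of vertices.
  record IsCycle (k : ℕ) (c : ℕ → Fin n) : Set where
    field
      3≤k      : 3 ≤ k
      adjacent : ∀ j → c j ~ c (suc j)
      periodic : ∀ j → c (j + k) ≡ c j
      distinct : ∀ {j l} → j < k → l < k → c j ≡ c l → j ≡ l

  HasGirth : ℕ → Set
  HasGirth g = ∃ (IsCycle g) × (∀ {k c} → IsCycle k c → g ≤ k)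

  N[_] : Fin n → Pred (Fin n) 0ℓ
  N[ v ] u = u ≡ v ⊎ v ~ u

  IsEDS : Pred (Fin n) 0ℓ → Set
  IsEDS S = ∀ v → HasSize (N[ v ] ∩ S) 1

  -- An edge with an orientation.  The adjacency proof is irrelevant so that
  -- a dart is determined by its ends.
  record Dart : Set where
    constructor dart
    field
      src tgt : Fin n
      .edge   : src ~ tgt

  open Dart public using (src; tgt)

  opp : Dart → Dart
  opp (dart u v e) = dart v u (~-sym e)

  -- σ d is the dart following d counterclockwise around src d.  Hence the
  -- orbits of φ traverse the faces clockwise, with the face on the right.
  record Rotation : Set where
    field
      σ        : Dart → Dart
      σ-src    : ∀ d → src (σ d) ≡ src d
      σ-cyclic : ∀ d d′ → src d ≡ src d′ → ∃ λ m → iterate σ d m ≡ d′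

    φ : Dart → Dart
    φ = σ ∘ opp

  -- Rotation systems are the cellular embeddings in closed orientable
  -- surfaces.  A connected graph embeds in the surface of genus g iff it has
  -- a cellular embedding in a surface of genus at most g.
  EmbedsIn : ℕ → Set
  EmbedsIn g = Σ Rotation λ R → ∃ λ h → h ≤ g × OfGenus (Rotation.σ R) opp h

  IsGenus : ℕ → Set
  IsGenus g = EmbedsIn g × (∀ h → EmbedsIn h → g ≤ h)

  record Map : Set where
    field
      rotation : Rotation
      genus    : ℕ
      minimal  : IsGenus genus
      ofGenus  : OfGenus (Rotation.σ rotation) opp genus

    open Rotation rotation public

    field
      #faces     : ℕ
      faceOrbits : Orbits φ #faces

    Face : Set
    Face = Fin #faces

    face : Dart → Face
    face = Orbits.orbit faceOrbits

    field
      len  : Face → ℕ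
      belt : ∀ d → IsCycle (len (face d)) (λ j → src (iterate φ d j))

    Adjacent : Face → Face → Set
    Adjacent f g = f ≢ g × ∃ λ d → face d ≡ f × face (opp d) ≡ g

  YVertex : Pred (Fin n) 0ℓ
  YVertex v = ∀ {c} → IsCycle 4 c → ∀ j → c j ≢ v

  YEdge : Pred Dart 0ℓ
  YEdge d = YVertex (src d) × YVertex (tgt d)

  record Coloring : Set where
    field
      vcol     : Fin n → Fin 4
      ecol     : Dart → Fin 4
      ecol-opp : ∀ d → ecol (opp d) ≡ ecol d

  module _ (μ : Coloring) where
    open Coloring μ

    record IsTotalColoring : Set where
      field
        vertex-vertex : ∀ {u v} → u ~ v → vcol u ≢ vcol v
        edge-edge     : ∀ {d d′} → src d ≡ src d′ → d ≢ d′ → ecol d ≢ ecol d′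
        edge-vertex   : ∀ d → ecol d ≢ vcol (src d)

    record IsETC : Set where
      field
        total : IsTotalColoring
        inj   : ∀ v {u w} → N[ v ] u → N[ v ] w → vcol u ≡ vcol w → u ≡ w
        surj  : ∀ v c → ∃ λ u → N[ v ] u × vcol u ≡ c
        eds   : ∀ c → IsEDS (λ v → vcol v ≡ c)

    record IsETGC : Set where
      field
        etc        : IsETC
        4-vertices : ∀ {c} → IsCycle 4 c →
          Bijective {A = Fin 4} _≡_ _≡_ (λ j → vcol (c (toℕ j)))
        4-edges    : ∀ {c} (C : IsCycle 4 c) →
          Bijective {A = Fin 4} _≡_ _≡_ (λ j →
            ecol (dart (c (toℕ j)) (c (suc (toℕ j))) (IsCycle.adjacent C (toℕ j))))

module _ {n : ℕ} {G : Graph n} (M : Map G) where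
  open Map M

  IsYMap : Set
  IsYMap = ∀ f → ∃ λ ℓ → len f ≡ 2 * ℓ ×
    (∀ d → face d ≡ f → YEdge G d → YEdge G (iterate φ d ℓ))

  IsΠMap : Set
  IsΠMap = IsYMap × Σ (Fin n → Fin 4) λ color →
    (∀ c → IsEDS G (λ v → color v ≡ c)) ×
    (∀ d → 4 ∣ len (face d) × Σ (Permutation′ 4) λ π →
      ∀ j → color (src (iterate φ d j)) ≡ π ⟨$⟩ʳ (j mod 4))

  -- s runs around the belt of f endlessly, from some starting dart on; f is on
  -- the left of an anticlockwise traversal.
  data Traverses (f : Face) (s : ℕ → Dart G) : Set where
    clockwise     : face (s 0) ≡ f →
                    (∀ j → s (suc j) ≡ φ (s j)) → Traverses f s
    anticlockwise : face (opp G (s 0)) ≡ f →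
                    (∀ j → opp G (s j) ≡ φ (opp G (s (suc j)))) → Traverses f s

  abcadcbd : Vec (Fin 4) 8
  abcadcbd = 0F ∷ 1F ∷ 2F ∷ 0F ∷ 3F ∷ 2F ∷ 1F ∷ 3F ∷ []

  -- The alternating sequence of a belt of length ℓ has 2ℓ terms, hence 4 ∣ ℓ.
  IsPeriodic : Coloring G → Set
  IsPeriodic μ′ = ∀ f → 4 ∣ len f ×
    Σ (ℕ → Dart G) λ s → Traverses f s × Σ (Permutation′ 4) λ π → ∀ j →
      vcol (src (s j)) ≡ π ⟨$⟩ʳ lookup abcadcbd ((2 * j) mod 8) ×
      ecol (s j) ≡ π ⟨$⟩ʳ lookup abcadcbd ((1 + 2 * j) mod 8)
    where open Coloring μ′

  -- {1,2,3} is represented by Fin 3, embedded in Fin 4 by suc.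
  IsAssociatedPFC : Coloring G → (Face → Permutation′ 3) → Set
  IsAssociatedPFC μ′ μ =
    (∀ d → vcol (src d) ≡ 0F → ∀ (k : Fin 3) →
      vcol (src (iterate φ d (suc (toℕ k)))) ≡ suc (μ (face d) ⟨$⟩ʳ k)) ×
    (∀ f g → Adjacent f g → ¬ μ f ≈ μ g)
    where open Coloring μ′

rotate : ∀ {N} → Fin N → Fin N
rotate {suc m} p = suc (toℕ p) mod suc m

-- The clockwise sides L₁,…,Lₙ,L₁⁻¹,…,Lₙ⁻¹ of a 2n-gon are indexed by
-- Fin (n + n) in this order.
oppositeSide : ∀ {n} → Fin (n + n) → Fin (n + n)
oppositeSide {n} s = join n n (Sum.swap (splitAt n s))

-- N points in the interiors of the sides, numbered clockwise, and their
-- identification when each side is glued to the opposite one.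
record Boundary (n : ℕ) : Set where
  field
    N               : ℕ
    side            : Fin N → Fin (n + n)
    side-≤          : ∀ {p q} → p Fin.≤ q → side p Fin.≤ side q
    glue            : Fin N → Fin N
    glue-involutive : ∀ p → glue (glue p) ≡ p
    glue-side       : ∀ p → side (glue p) ≡ oppositeSide {n} (side p)
    glue-reverses   : ∀ {p q} → side p ≡ side q → p Fin.< q → glue q Fin.< glue p

-- One arrives at the dart d by following the arc from its end x, continuing
-- from the opposite side whenever the boundary is met.
data Reaches {D : Set} {N : ℕ} (glue : Fin N → Fin N) (arc : D ⊎ Fin N → D ⊎ Fin N)
             (x : D ⊎ Fin N) (d : D) : Set where
  arrive : arc x ≡ inj₁ d → Reaches glue arc x d
  cross  : ∀ {p} → arc x ≡ inj₂ p → Reaches glue arc (inj₂ (glue p)) d →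
           Reaches glue arc x d

-- A drawing in a 2n-gon whose vertices are interior and whose edges meet the
-- boundary in the given points.  Cutting the edges there leaves arcs; the ends
-- of the arcs are the darts (at the vertices) and the boundary points.
--
-- Shrinking the boundary of the polygon to a point turns the polygon into a
-- sphere and the drawing into a map on it with one additional vertex.
-- Counterclockwise around this vertex, the boundary points appear in their
-- clockwise order along the polygon.
--
-- After gluing, the arcs form exactly the edges of the graph, and the rotation
-- at each vertex is that of M.  As the polygon glues to a surface of the genus
-- of M, the quotient is M.
record Cutout (n : ℕ) {m : ℕ} {G : Graph m} (M : Map G) : Set where
  open Map M
  field
    genus≡   : genus ≡ ⌊ n /2⌋
    boundary : Boundary n

  open Boundary boundary public

  End : Set
  End = Dart G ⊎ Fin N

  field
    arc            : End → End
    arc-involutive : ∀ x → arc (arc x) ≡ x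
    arc-no-fix     : ∀ x → arc x ≢ x
    planar         : OfGenus (Sum.map σ rotate) arc 0

  infix 4 _⇝_
  _⇝_ : End → Dart G → Set
  _⇝_ = Reaches glue arc

  field
    edges     : ∀ d → inj₁ d ⇝ opp G d
    allOnEdge : ∀ p → ∃ λ d → inj₂ p ⇝ d

{-# OPTIONS --safe #-}
module Submission where

-- Let m = 2i + 1.  The graph G is the cyclic m-fold cover of the cube with the
-- following voltages in the integers modulo m.  Let t₀ t₁ t₂ t₃ and b₀ b₁ b₂ b₃
-- be two opposite faces of the cube, with the edges tₖ b₃₋ₖ between them.  The
-- edges from t₃ to t₀ and from b₃ to b₀ have voltage 1, all others voltage 0.
-- Thus G consists of m ladders with four rungs each; the right end of the top of
-- each ladder is joined to the left end of the top of the next one, and the left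
-- end of its bottom to the right end of the bottom of the next one.
--
-- The rotation of the cube on the sphere lifts to G.  The face of the cube
-- between tₖ tₖ₊₁ and b₂₋ₖ b₃₋ₖ, for k < 3, has net voltage 0 and lifts to m
-- squares; the faces t and b have net voltage -1 around them, and the face
-- between t₃ t₀ and b₃ b₀ has net voltage 2.  As m is odd, -1 and 2 are units, so
-- each of these three faces lifts to one face of length 4m = 8i + 4.  The Euler
-- formula gives genus i.  In general, `orbits` computes the orbits of a
-- permutation of Z/m × B that covers a permutation of a finite set B, from data
-- about B that do not depend on m and are checked by evaluation.  It is used for
-- the vertices, edges and faces of G and of the drawing in the polygon.
--
-- The colours are lifted from the cube as well.  Since G covers the cube, every
-- 4-cycle of G lies over a closed walk of length 4 in the cube without
-- backtracking, so that the conditions on 4-cycles, closed neighbourhoods and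
-- belts all become finite checks on the cube.
--
-- The genus of G is not smaller than i because no rotation system on G has more
-- than 3m + 4 faces (`faces-≤`); Euler's formula then gives 2h ≥ 2i - 1.  To see
-- the bound, cut the cyclic chain of ladders open between the last ladder and
-- ladder 0, which cuts 2 edges, that is, 4 darts.  For each of the 2⁸ choices of
-- rotations at the vertices of one ladder, there are 3 darts in the ladder such
-- that every face walk that starts in the ladder meets one of them or leaves
-- the ladder, and that every face walk that enters from the preceding ladder
-- meets one of them or proceeds to the following ladder (`stops-exist`).  A face
-- that avoids all the selected darts would therefore proceed in one direction
-- until it reaches the cut.  Hence every face contains one of 4 + 3m darts.
--
-- For the cutout, cut every ladder across, through the middle of its middle
-- square, from the face t to the face b.  What remains is the face of net voltage 2
-- with 2m half ladders around it, that is, a 2m-gon, and the two halves of a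
-- ladder are at opposite sides, as m is odd.

open import Defs
open import Level using (0ℓ)
open import Data.Bool as Bool using (Bool; true; false; not; _∨_; T)
open import Data.Bool.Properties using (T?; T-∨)
open import Data.Empty using (⊥-elim)
open import Data.Nat as ℕ using (ℕ; zero; suc; _+_; _*_; _≤_; _<_; _/_; _%_; ⌊_/2⌋; s≤s; z≤n)
import Data.Nat.Properties as ℕ
open import Data.Nat.DivMod using (_mod_; m%n<n; m≡m%n+[m/n]*n; m<n⇒m%n≡m; m%n%n≡m%n; n%n≡0;
  m<n*o⇒m/o<n; [m+kn]%n≡m%n; %-distribˡ-+)
open import Data.Nat.Divisibility using (_∣_; divides)
open import Data.Nat.GeneralisedArithmetic using (iterate)
open import Data.Nat.Tactic.RingSolver using (solve-∀)
open import Data.Integer as ℤ using (ℤ; +_; -[1+_])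
import Data.Integer.Properties as ℤ
import Data.Integer.Tactic.RingSolver as ℤ
open import Data.Fin as Fin using (Fin; zero; suc; toℕ; fromℕ; _↑ˡ_; _↑ʳ_; combine; remQuot; splitAt; join)
open import Data.Fin.Patterns
import Data.Fin.Properties as Fin
open import Data.Fin.Permutation using (Permutation′; permutation; _⟨$⟩ʳ_; _∘ₚ_; _≈_)
open import Data.Product using (Σ; ∃; _×_; _,_; proj₁; proj₂; uncurry)
import Data.Product.Properties as Product
open import Data.Sum as Sum using (_⊎_; inj₁; inj₂; [_,_]′)
import Data.Sum.Properties as Sum
open import Data.Vec using (Vec; []; _∷_; lookup; tabulate)
open import Data.Vec.Properties using (lookup∘tabulate)
open import Data.Unit using (tt)
open import Function using (_∘_; id; const; mk⇔; Equivalence; Bijective)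
open import Relation.Binary using (DecidableEquality)
open import Relation.Binary.Construct.Closure.ReflexiveTransitive using (Star; ε; _◅_; _◅◅_)
open import Relation.Binary.PropositionalEquality
  using (_≡_; _≢_; refl; sym; trans; cong; cong₂; subst; subst₂; module ≡-Reasoning)
open import Relation.Nullary using (Dec; yes; no; ¬_; contradiction)
open import Relation.Nullary.Decidable
  using (map′; _×-dec_; _→-dec_; _⊎-dec_; ¬?; True; isYes; toWitness; from-yes; recompute)
open import Relation.Unary using (Pred; _∈_; _∉_; _⊆_)
-- Iteration and orbits

-- Euler's formula with 8m vertices, 12m edges and at most 4 + 3m faces, where
-- m = 2i + 1, gives 2h ≥ 2i - 1.
genus-bound : ∀ i h {V E F} → V ≤ suc (2 * i) * 8 → suc (2 * i) * 12 ≤ E →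
              F ≤ 4 + suc (2 * i) * 3 → V + F + 2 * h ≡ E + 2 → i ≤ h
genus-bound i h {V} {E} {F} V≤ E≥ F≤ euler = ℕ.≤-pred (ℕ.*-cancelˡ-< 2 i (suc h)
  (ℕ.+-cancelʳ-≤ (17 + 22 * i) (suc (2 * i)) (2 * suc h) (begin
    suc (2 * i) + (17 + 22 * i)                            ≡⟨ edges i ⟩
    suc (2 * i) * 12 + 2 + 4                               ≤⟨ ℕ.+-monoˡ-≤ 4 (ℕ.+-monoˡ-≤ 2 E≥) ⟩
    E + 2 + 4                                              ≡⟨ cong (λ z → z + 4) euler ⟨
    V + F + 2 * h + 4                                      ≤⟨ ℕ.+-monoˡ-≤ 4 (ℕ.+-monoˡ-≤ (2 * h) (ℕ.+-mono-≤ V≤ F≤)) ⟩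
    suc (2 * i) * 8 + (4 + suc (2 * i) * 3) + 2 * h + 4    ≡⟨ cells i h ⟩
    2 * suc h + (17 + 22 * i)                              ∎)))
  where
  open ℕ.≤-Reasoning
  edges : ∀ i → suc (2 * i) + (17 + 22 * i) ≡ suc (2 * i) * 12 + 2 + 4
  edges = solve-∀
  cells : ∀ i h → suc (2 * i) * 8 + (4 + suc (2 * i) * 3) + 2 * h + 4 ≡ 2 * suc h + (17 + 22 * i)
  cells = solve-∀

open ≡-Reasoning

iterate-+ : {A : Set} (f : A → A) (x : A) (m n : ℕ) →
            iterate f x (m + n) ≡ iterate f (iterate f x m) n
iterate-+ f x zero    n = refl
iterate-+ f x (suc m) n = iterate-+ f (f x) m n

iterate-semiconj : {A B : Set} {f : A → A} {g : B → B} (h : A → B) →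
                   (∀ x → h (f x) ≡ g (h x)) →
                   ∀ x n → h (iterate f x n) ≡ iterate g (h x) n
iterate-semiconj h comm x zero = refl
iterate-semiconj {f = f} {g} h comm x (suc n) =
  trans (iterate-semiconj h comm (f x) n) (cong (λ y → iterate g y n) (comm x))

toℕ-mod : ∀ a n .{{_ : ℕ.NonZero n}} → toℕ (a mod n) ≡ a % n
toℕ-mod a n = Fin.toℕ-fromℕ< (m%n<n a n)

mod-cong : ∀ a b n .{{_ : ℕ.NonZero n}} → a % n ≡ b % n → a mod n ≡ b mod n
mod-cong a b n e = Fin.toℕ-injective (trans (toℕ-mod a n) (trans e (sym (toℕ-mod b n))))

-- Orbits of conjugate permutations correspond.
transfer : {A B : Set} {f : A → A} {g : B → B} {k : ℕ}
           (to : A → B) (from : B → A) →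
           (∀ x → from (to x) ≡ x) → (∀ y → to (from y) ≡ y) →
           (∀ x → to (f x) ≡ g (to x)) → Orbits g k → Orbits f k
transfer {A} {B} {f} {g} to from from-to to-from comm O = record
  { orbit = λ x → O.orbit (to x)
  ; onto  = λ c → let y , e = O.onto c in from y , trans (cong O.orbit (to-from y)) e
  ; same  = λ x y → mk⇔
      (λ e → let m , e′ = Equivalence.to (O.same (to x) (to y)) e in
        m , trans (sym (from-to _))
              (trans (cong from (trans (iterate-semiconj to comm x m) e′)) (from-to y)))
      (λ { (m , e) → Equivalence.from (O.same (to x) (to y))
             (m , trans (sym (iterate-semiconj to comm x m)) (cong to e)) })
  }
  where module O = Orbits O

-- Exhaustive search

-- Sets on which universal quantification is decidable by search.
record Finite (A : Set) : Set₁ where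
  field
    every? : {P : A → Set} → (∀ x → Dec (P x)) → Dec (∀ x → P x)

open Finite {{...}} public

instance
  finite-Fin : ∀ {n} → Finite (Fin n)
  finite-Fin = record { every? = Fin.all? }

  finite-× : {A B : Set} → {{Finite A}} → {{Finite B}} → Finite (A × B)
  finite-× = record { every? = λ P? →
    map′ (λ h (x , y) → h x y) (λ h x y → h (x , y)) (every? λ x → every? λ y → P? (x , y)) }

  finite-⊎ : {A B : Set} → {{Finite A}} → {{Finite B}} → Finite (A ⊎ B)
  finite-⊎ = record { every? = λ P? →
    map′ (λ (f , g) → λ { (inj₁ x) → f x ; (inj₂ y) → g y })
         (λ h → h ∘ inj₁ , h ∘ inj₂)
         (every? (P? ∘ inj₁) ×-dec every? (P? ∘ inj₂)) }

  finite-Vec : ∀ {n} → Finite (Vec Bool n)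
  finite-Vec {zero}  = record { every? = λ P? → map′ (λ { h [] → h }) (λ h → h []) (P? []) }
  finite-Vec {suc n} = record { every? = λ P? →
    map′ (λ { (f , g) (false ∷ w) → f w ; (f , g) (true ∷ w) → g w })
         (λ h → (λ w → h (false ∷ w)) , λ w → h (true ∷ w))
         (every? (λ w → P? (false ∷ w)) ×-dec every? (λ w → P? (true ∷ w))) }

-- Cyclic covers of permutations

-- The orbits of a permutation f of B, together with a function v which assigns
-- a voltage to each step from b to f b.  The p orbits inj₁ c are the ones around
-- which the net voltage is going to be a unit modulo m, the q orbits inj₂ c are the
-- ones of net voltage 0; rep chooses a point in each orbit.  On the latter orbits,
-- pot b is the total voltage of the way from b to the representative.
record BaseOrbits {B : Set} (f : B → B) (v : B → ℤ) (p q : ℕ) : Set where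
  field
    type     : B → Fin p ⊎ Fin q
    rep      : Fin p ⊎ Fin q → B
    pot      : B → ℤ
    type-rep : ∀ t → type (rep t) ≡ t
    type-f   : ∀ b → type (f b) ≡ type b
    toRep    : ∀ b → ∃ λ n → iterate f b n ≡ rep (type b)
    fromRep  : ∀ b → ∃ λ n → iterate f (rep (type b)) n ≡ b
    pot-f    : ∀ b c → type b ≡ inj₂ c → v b ℤ.+ pot (f b) ≡ pot b
    pot-rep  : ∀ c → pot (rep (inj₂ c)) ≡ + 0

module _ {B : Set} {{_ : Finite B}} (_≟_ : DecidableEquality B)
         (f : B → B) (v : B → ℤ) {p q : ℕ}
         (type : B → Fin p ⊎ Fin q) (rep : Fin p ⊎ Fin q → B) (pot : B → ℤ) where
  private
    _≟′_ : DecidableEquality (Fin p ⊎ Fin q)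
    _≟′_ = Sum.≡-dec Fin._≟_ Fin._≟_

    check = every? (λ t → type (rep t) ≟′ t)
      ×-dec every? (λ b → type (f b) ≟′ type b)
      ×-dec every? (λ b → Fin.any? λ (n : Fin 6) → iterate f b (toℕ n) ≟ rep (type b))
      ×-dec every? (λ b → Fin.any? λ (n : Fin 6) → iterate f (rep (type b)) (toℕ n) ≟ b)
      ×-dec every? (λ b → every? λ c → (type b ≟′ inj₂ c) →-dec (v b ℤ.+ pot (f b) ℤ.≟ pot b))
      ×-dec every? (λ c → pot (rep (inj₂ c)) ℤ.≟ + 0)

  -- All conditions are decided by evaluation.  Only the orbits of at most 6 points
  -- have to be found: no orbit considered below is longer.
  baseOrbits : True check → BaseOrbits f v p q
  baseOrbits ok = let a , b , c , d , e , g = toWitness ok in record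
    { type = type ; rep = rep ; pot = pot ; type-rep = a ; type-f = b
    ; toRep   = λ x → let n , h = c x in toℕ n , h
    ; fromRep = λ x → let n , h = d x in toℕ n , h
    ; pot-f = e ; pot-rep = g }

-- The integers acting on a cycle

-- Fin m with the action of the integers by translations modulo m, where
-- m = k + 1.
module Cyclic (k : ℕ) where

  m : ℕ
  m = suc k

  [_] : ℕ → Fin m
  [ q ] = q mod m

  toℕ-[] : ∀ q → toℕ [ q ] ≡ q % m
  toℕ-[] q = toℕ-mod q m

  []-cong : ∀ a b → a % m ≡ b % m → [ a ] ≡ [ b ]
  []-cong a b = mod-cong a b m

  []-toℕ : ∀ j → [ toℕ j ] ≡ j
  []-toℕ j = Fin.toℕ-injective (trans (toℕ-[] (toℕ j)) (m<n⇒m%n≡m (Fin.toℕ<n j)))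

  []-+m : ∀ a c → [ a + c * m ] ≡ [ a ]
  []-+m a c = []-cong (a + c * m) a ([m+kn]%n≡m%n a c m)

  %-absorbˡ : ∀ a b → (a % m + b) % m ≡ (a + b) % m
  %-absorbˡ a b = begin
    (a % m + b) % m            ≡⟨ %-distribˡ-+ (a % m) b m ⟩
    (a % m % m + b % m) % m    ≡⟨ cong (λ z → (z + b % m) % m) (m%n%n≡m%n a m) ⟩
    (a % m + b % m) % m        ≡⟨ %-distribˡ-+ a b m ⟨
    (a + b) % m                ∎

  []-+ : ∀ a b → [ toℕ [ a ] + b ] ≡ [ a + b ]
  []-+ a b = trans (cong (λ z → [ z + b ]) (toℕ-[] a)) ([]-cong (a % m + b) (a + b) (%-absorbˡ a b))

  -- A natural number in the same residue class: -1 is k modulo m.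
  ⟪_⟫ : ℤ → ℕ
  ⟪ + n      ⟫ = n
  ⟪ -[1+ n ] ⟫ = k * suc n

  ⟪⟫-⊖ : ∀ a b c → [ c + ⟪ a ℤ.⊖ b ⟫ ] ≡ [ c + (a + k * b) ]
  ⟪⟫-⊖ a zero c =
    cong (λ z → [ c + z ]) (trans (sym (ℕ.+-identityʳ a)) (cong (λ y → a + y) (sym (ℕ.*-zeroʳ k))))
  ⟪⟫-⊖ zero    (suc b) c = refl
  ⟪⟫-⊖ (suc a) (suc b) c = begin
    [ c + ⟪ suc a ℤ.⊖ suc b ⟫ ]      ≡⟨ cong (λ z → [ c + ⟪ z ⟫ ]) (ℤ.[1+m]⊖[1+n]≡m⊖n a b) ⟩
    [ c + ⟪ a ℤ.⊖ b ⟫ ]              ≡⟨ ⟪⟫-⊖ a b c ⟩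
    [ c + (a + k * b) ]              ≡⟨ []-+m (c + (a + k * b)) 1 ⟨
    [ c + (a + k * b) + 1 * suc k ]  ≡⟨ cong [_] (lemma c a k b) ⟩
    [ c + (suc a + k * suc b) ]      ∎
    where
    lemma : ∀ c a k b → c + (a + k * b) + 1 * suc k ≡ c + (suc a + k * suc b)
    lemma = solve-∀

  ⟪⟫-+ : ∀ c a b → [ c + ⟪ a ⟫ + ⟪ b ⟫ ] ≡ [ c + ⟪ a ℤ.+ b ⟫ ]
  ⟪⟫-+ c (+ a)      (+ b)      = cong [_] (ℕ.+-assoc c a b)
  ⟪⟫-+ c (+ a)      (-[1+ b ]) =
    trans (cong [_] (ℕ.+-assoc c a (k * suc b))) (sym (⟪⟫-⊖ a (suc b) c))
  ⟪⟫-+ c (-[1+ a ]) (+ b)      = trans (cong [_] (lemma c (k * suc a) b)) (sym (⟪⟫-⊖ b (suc a) c))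
    where
    lemma : ∀ c x b → c + x + b ≡ c + (b + x)
    lemma = solve-∀
  ⟪⟫-+ c (-[1+ a ]) (-[1+ b ]) = cong [_] (lemma c k a b)
    where
    lemma : ∀ c k a b → c + k * suc a + k * suc b ≡ c + k * suc (suc (a + b))
    lemma = solve-∀

  -- Translation of j by z.  The definition is kept abstract, so that only the laws
  -- below are available to later definitions.
  infixl 6 _⊕_

  abstract
    _⊕_ : Fin m → ℤ → Fin m
    j ⊕ z = [ toℕ j + ⟪ z ⟫ ]

    ⊕-0 : ∀ j → j ⊕ + 0 ≡ j
    ⊕-0 j = trans (cong [_] (ℕ.+-identityʳ (toℕ j))) ([]-toℕ j)

    ⊕-+ : ∀ j a b → j ⊕ a ⊕ b ≡ j ⊕ (a ℤ.+ b)
    ⊕-+ j a b = trans ([]-+ (toℕ j + ⟪ a ⟫) ⟪ b ⟫) (⟪⟫-+ (toℕ j) a b)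

    ⊕-m : ∀ j → j ⊕ + m ≡ j
    ⊕-m j = begin
      [ toℕ j + m ]      ≡⟨ cong (λ z → [ toℕ j + z ]) (ℕ.*-identityˡ m) ⟨
      [ toℕ j + 1 * m ]  ≡⟨ []-+m (toℕ j) 1 ⟩
      [ toℕ j ]          ≡⟨ []-toℕ j ⟩
      j                  ∎

    ⊕-transitive : ∀ j j′ → ∃ λ a → j ⊕ + a ≡ j′
    ⊕-transitive j j′ = toℕ j′ + k * toℕ j , (begin
      [ toℕ j + (toℕ j′ + k * toℕ j) ]  ≡⟨ cong [_] (lemma (toℕ j) (toℕ j′) k) ⟩
      [ toℕ j′ + toℕ j * m ]            ≡⟨ []-+m (toℕ j′) (toℕ j) ⟩
      [ toℕ j′ ]                        ≡⟨ []-toℕ j′ ⟩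
      j′                                ∎)
      where
      lemma : ∀ a b k → a + (b + k * a) ≡ b + a * suc k
      lemma = solve-∀

    toℕ-zero-⊕ : ∀ a → toℕ (zero {k} ⊕ + a) ≡ a % m
    toℕ-zero-⊕ = toℕ-[]

    zero-⊕-toℕ : ∀ j → zero ⊕ + toℕ j ≡ j
    zero-⊕-toℕ = []-toℕ

  ⊕-toℕ : ∀ j a → toℕ (j ⊕ + a) ≡ (toℕ j + a) % m
  ⊕-toℕ j a = begin
    toℕ (j ⊕ + a)                  ≡⟨ cong (λ z → toℕ (z ⊕ + a)) (zero-⊕-toℕ j) ⟨
    toℕ (zero ⊕ + toℕ j ⊕ + a)     ≡⟨ cong toℕ (⊕-+ zero (+ toℕ j) (+ a)) ⟩
    toℕ (zero ⊕ + (toℕ j + a))     ≡⟨ toℕ-zero-⊕ (toℕ j + a) ⟩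
    (toℕ j + a) % m                ∎

  toℕ-⊕1 : ∀ j → toℕ j < k → toℕ (j ⊕ + 1) ≡ suc (toℕ j)
  toℕ-⊕1 j j<k = begin
    toℕ (j ⊕ + 1)       ≡⟨ ⊕-toℕ j 1 ⟩
    (toℕ j + 1) % m     ≡⟨ cong (_% m) (ℕ.+-comm (toℕ j) 1) ⟩
    suc (toℕ j) % m     ≡⟨ m<n⇒m%n≡m (s≤s j<k) ⟩
    suc (toℕ j)         ∎

  toℕ-⊕-1 : ∀ j {n} → toℕ j ≡ suc n → toℕ (j ⊕ -[1+ 0 ]) ≡ n
  toℕ-⊕-1 j {n} e = begin
    toℕ (j ⊕ -[1+ 0 ])                  ≡⟨ cong (λ z → toℕ (z ⊕ -[1+ 0 ])) (zero-⊕-toℕ j) ⟨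
    toℕ (zero ⊕ + toℕ j ⊕ -[1+ 0 ])     ≡⟨ cong toℕ (⊕-+ zero (+ toℕ j) -[1+ 0 ]) ⟩
    toℕ (zero ⊕ (toℕ j ℤ.⊖ 1))          ≡⟨ cong (λ z → toℕ (zero ⊕ (z ℤ.⊖ 1))) e ⟩
    toℕ (zero ⊕ + n)                    ≡⟨ toℕ-zero-⊕ n ⟩
    n % m                               ≡⟨ m<n⇒m%n≡m (ℕ.<-trans (ℕ.≤-reflexive (sym e)) (Fin.toℕ<n j)) ⟩
    n                                   ∎

  ⊕-cancel : ∀ j a → j ⊕ a ⊕ ℤ.- a ≡ j
  ⊕-cancel j a = trans (⊕-+ j a (ℤ.- a)) (trans (cong (j ⊕_) (ℤ.+-inverseʳ a)) (⊕-0 j))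

  -- Congruence of integers modulo m, as equality of translations.
  infix 4 _≋_
  _≋_ : ℤ → ℤ → Set
  a ≋ b = ∀ j → j ⊕ a ≡ j ⊕ b

  ≋-*ˡ : ∀ {a b} → a ≋ b → ∀ n → + n ℤ.* a ≋ + n ℤ.* b
  ≋-*ˡ {a} {b} e zero    j = refl
  ≋-*ˡ {a} {b} e (suc n) j = begin
    j ⊕ (+ suc n ℤ.* a)    ≡⟨ cong (j ⊕_) (ℤ.suc-* (+ n) a) ⟩
    j ⊕ (a ℤ.+ + n ℤ.* a)  ≡⟨ ⊕-+ j a _ ⟨
    j ⊕ a ⊕ (+ n ℤ.* a)    ≡⟨ cong (_⊕ (+ n ℤ.* a)) (e j) ⟩
    j ⊕ b ⊕ (+ n ℤ.* a)    ≡⟨ ≋-*ˡ e n (j ⊕ b) ⟩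
    j ⊕ b ⊕ (+ n ℤ.* b)    ≡⟨ ⊕-+ j b _ ⟩
    j ⊕ (b ℤ.+ + n ℤ.* b)  ≡⟨ cong (j ⊕_) (ℤ.suc-* (+ n) b) ⟨
    j ⊕ (+ suc n ℤ.* b)    ∎

  ⊕-m* : ∀ w j → j ⊕ (+ m ℤ.* w) ≡ j
  ⊕-m* w j = trans (cong (j ⊕_) (ℤ.*-comm (+ m) w)) (multiple w j)
    where
    natural : ∀ n j → j ⊕ (+ n ℤ.* + m) ≡ j
    natural n j = trans (≋-*ˡ (λ j → trans (⊕-m j) (sym (⊕-0 j))) n j)
      (trans (cong (j ⊕_) (ℤ.*-zeroʳ (+ n))) (⊕-0 j))
    multiple : ∀ w j → j ⊕ (w ℤ.* + m) ≡ j
    multiple (+ n)      j = natural n j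
    multiple (-[1+ n ]) j = begin
      j ⊕ (-[1+ n ] ℤ.* + m)                          ≡⟨ cong (_⊕ (-[1+ n ] ℤ.* + m)) (natural (suc n) j) ⟨
      j ⊕ (+ suc n ℤ.* + m) ⊕ (-[1+ n ] ℤ.* + m)      ≡⟨ ⊕-cancel j (+ suc n ℤ.* + m) ⟩
      j                                               ∎

  -- Since the action is transitive and commutative, a stabiliser is trivial.
  ≋-from-one : ∀ a b j → j ⊕ a ≡ j ⊕ b → a ≋ b
  ≋-from-one a b j e j′ with ⊕-transitive j j′
  ... | z , refl = begin
    j ⊕ + z ⊕ a      ≡⟨ ⊕-+ j (+ z) a ⟩
    j ⊕ (+ z ℤ.+ a)  ≡⟨ cong (j ⊕_) (ℤ.+-comm (+ z) a) ⟩
    j ⊕ (a ℤ.+ + z)  ≡⟨ ⊕-+ j a (+ z) ⟨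
    j ⊕ a ⊕ + z      ≡⟨ cong (_⊕ + z) e ⟩
    j ⊕ b ⊕ + z      ≡⟨ ⊕-+ j b (+ z) ⟩
    j ⊕ (b ℤ.+ + z)  ≡⟨ cong (j ⊕_) (ℤ.+-comm b (+ z)) ⟩
    j ⊕ (+ z ℤ.+ b)  ≡⟨ ⊕-+ j (+ z) b ⟨
    j ⊕ + z ⊕ b      ∎

  -- The units modulo m, with a natural number u as inverse.
  Unit : ℤ → Set
  Unit w = ∃ λ u → + u ℤ.* w ≋ + 1

  -- The multiples of a unit act transitively.
  unit-transitive : ∀ {w} → Unit w → ∀ j j′ → ∃ λ a → j ⊕ (+ a ℤ.* w) ≡ j′
  unit-transitive {w} (u , law) j j′ = let z , e = ⊕-transitive j j′ in z * u , (begin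
    j ⊕ (+ (z * u) ℤ.* w)      ≡⟨ cong (λ t → j ⊕ (t ℤ.* w)) (ℤ.pos-* z u) ⟩
    j ⊕ (+ z ℤ.* + u ℤ.* w)    ≡⟨ cong (j ⊕_) (ℤ.*-assoc (+ z) (+ u) w) ⟩
    j ⊕ (+ z ℤ.* (+ u ℤ.* w))  ≡⟨ ≋-*ˡ law z j ⟩
    j ⊕ (+ z ℤ.* + 1)          ≡⟨ cong (j ⊕_) (ℤ.*-identityʳ (+ z)) ⟩
    j ⊕ + z                    ≡⟨ e ⟩
    j′                         ∎)

  -- The first m multiples of a unit act differently.
  unit-injective : ∀ {w} → Unit w → ∀ j {a b} → a < m → b < m →
                   j ⊕ (+ a ℤ.* w) ≡ j ⊕ (+ b ℤ.* w) → a ≡ b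
  unit-injective {w} (u , law) j {a} {b} a<m b<m e = begin
    a              ≡⟨ m<n⇒m%n≡m a<m ⟨
    a % m          ≡⟨ toℕ-zero-⊕ a ⟨
    toℕ (zero ⊕ + a)  ≡⟨ cong toℕ (trans (sym (back a zero)) (trans
      (≋-*ˡ (≋-from-one (+ a ℤ.* w) (+ b ℤ.* w) j e) u zero) (back b zero))) ⟩
    toℕ (zero ⊕ + b)  ≡⟨ toℕ-zero-⊕ b ⟩
    b % m          ≡⟨ m<n⇒m%n≡m b<m ⟩
    b              ∎
    where
    swap : ∀ u a w → u ℤ.* (a ℤ.* w) ≡ a ℤ.* (u ℤ.* w)
    swap = ℤ.solve-∀
    back : ∀ a → + u ℤ.* (+ a ℤ.* w) ≋ + a
    back a j = trans (cong (j ⊕_) (swap (+ u) (+ a) w))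
                (trans (≋-*ˡ law a j) (cong (j ⊕_) (ℤ.*-identityʳ (+ a))))

  -- The inverse of -1 is k.
  unit-negative-one : Unit (ℤ.- (+ 1))
  unit-negative-one = k , λ j → begin
    j ⊕ (+ k ℤ.* ℤ.- + 1)              ≡⟨ cong (_⊕ (+ k ℤ.* ℤ.- + 1)) (⊕-m j) ⟨
    j ⊕ + m ⊕ (+ k ℤ.* ℤ.- + 1)        ≡⟨ ⊕-+ j (+ m) (+ k ℤ.* ℤ.- + 1) ⟩
    j ⊕ (+ m ℤ.+ + k ℤ.* ℤ.- + 1)      ≡⟨ cong (j ⊕_) (lemma (+ k)) ⟩
    j ⊕ + 1                            ∎
    where
    lemma : ∀ k → (+ 1 ℤ.+ k) ℤ.+ k ℤ.* ℤ.- + 1 ≡ + 1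
    lemma = ℤ.solve-∀

  -- The inverse of 2 modulo 2i + 1 is i + 1.
  unit-2 : ∀ {i} → k ≡ 2 * i → Unit (+ 2)
  unit-2 {i} e = suc i , λ j → begin
    j ⊕ (+ suc i ℤ.* + 2)    ≡⟨ cong (j ⊕_) (trans (sym (ℤ.pos-* (suc i) 2)) (cong +_ (trans (lemma i) (cong (λ z → suc z + 1) (sym e))))) ⟩
    j ⊕ (+ m ℤ.+ + 1)        ≡⟨ ⊕-+ j (+ m) (+ 1) ⟨
    j ⊕ + m ⊕ + 1            ≡⟨ cong (_⊕ + 1) (⊕-m j) ⟩
    j ⊕ + 1                  ∎
    where
    lemma : ∀ i → suc i * 2 ≡ suc (2 * i) + 1
    lemma = solve-∀

  -- The permutation of Fin m × B which covers f and translates by the voltages.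
  module Cover {B : Set} (f : B → B) (v : B → ℤ) where

    lift : Fin m × B → Fin m × B
    lift (j , b) = j ⊕ v b , f b

    -- The total voltage of the first n steps from b.
    volt : B → ℕ → ℤ
    volt b zero    = + 0
    volt b (suc n) = v b ℤ.+ volt (f b) n

    iterate-lift : ∀ j b n → iterate lift (j , b) n ≡ (j ⊕ volt b n , iterate f b n)
    iterate-lift j b zero    = cong (_, b) (sym (⊕-0 j))
    iterate-lift j b (suc n) =
      trans (iterate-lift (j ⊕ v b) (f b) n)
            (cong (_, iterate f b (suc n)) (⊕-+ j (v b) (volt (f b) n)))

    -- Going a times around a closed walk of net voltage w.
    iterate-loop : ∀ {b L w} → iterate f b L ≡ b → volt b L ≡ w →
                   ∀ a j → iterate lift (j , b) (a * L) ≡ (j ⊕ (+ a ℤ.* w) , b)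
    iterate-loop e₁ e₂ zero    j = cong (_, _) (sym (⊕-0 j))
    iterate-loop {b} {L} {w} e₁ e₂ (suc a) j = begin
      iterate lift (j , b) (L + a * L)                   ≡⟨ iterate-+ lift (j , b) L (a * L) ⟩
      iterate lift (iterate lift (j , b) L) (a * L)      ≡⟨ cong (λ x → iterate lift x (a * L)) (iterate-lift j b L) ⟩
      iterate lift (j ⊕ volt b L , iterate f b L) (a * L) ≡⟨ cong₂ (λ x y → iterate lift (j ⊕ x , y) (a * L)) e₂ e₁ ⟩
      iterate lift (j ⊕ w , b) (a * L)                   ≡⟨ iterate-loop e₁ e₂ a (j ⊕ w) ⟩
      (j ⊕ w ⊕ (+ a ℤ.* w) , b)                          ≡⟨ cong (_, b) (⊕-+ j w _) ⟩
      (j ⊕ (w ℤ.+ + a ℤ.* w) , b)                        ≡⟨ cong (λ z → (j ⊕ z , b)) (ℤ.suc-* (+ a) w) ⟨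
      (j ⊕ (+ suc a ℤ.* w) , b)                          ∎

    -- An orbit of unit net voltage lifts to one orbit, and an orbit of net voltage 0
    -- lifts to m orbits, each of which meets the fibre of the representative once.
    module Label {p q : ℕ} (O : BaseOrbits f v p q) where
      open BaseOrbits O

      -- The label of (j , b) when b is on the orbit t of f.
      label′ : Fin m × B → Fin p ⊎ Fin q → Fin (p + m * q)
      label′ (j , b) (inj₁ c) = c ↑ˡ (m * q)
      label′ (j , b) (inj₂ c) = p ↑ʳ combine (j ⊕ pot b) c

      label : Fin m × B → Fin (p + m * q)
      label (j , b) = label′ (j , b) (type b)

    module _ {p q : ℕ} (O : BaseOrbits f v p q)
             (loop : ∀ c → ∃ λ L → iterate f (BaseOrbits.rep O (inj₁ c)) L ≡ BaseOrbits.rep O (inj₁ c) ×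
                           Unit (volt (BaseOrbits.rep O (inj₁ c)) L)) where
      open BaseOrbits O
      open Label O

      private
        label-lift : ∀ x → label (lift x) ≡ label x
        label-lift (j , b) rewrite type-f b with type b in eq
        ... | inj₁ c = refl
        ... | inj₂ c = cong (λ z → p ↑ʳ combine z c)
                         (trans (⊕-+ j (v b) _) (cong (j ⊕_) (pot-f b c eq)))

        label-iterate : ∀ n x → label (iterate lift x n) ≡ label x
        label-iterate zero    x = refl
        label-iterate (suc n) x = trans (label-iterate n (lift x)) (label-lift x)

        type-iterate : ∀ n b → type (iterate f b n) ≡ type b
        type-iterate zero    b = refl
        type-iterate (suc n) b = trans (type-iterate n (f b)) (type-f b)

        volt-pot : ∀ n b {c} → type b ≡ inj₂ c → volt b n ℤ.+ pot (iterate f b n) ≡ pot b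
        volt-pot zero    b e = ℤ.+-identityˡ (pot b)
        volt-pot (suc n) b e = begin
          v b ℤ.+ volt (f b) n ℤ.+ pot (iterate f (f b) n)    ≡⟨ ℤ.+-assoc (v b) _ _ ⟩
          v b ℤ.+ (volt (f b) n ℤ.+ pot (iterate f (f b) n))  ≡⟨ cong (λ z → v b ℤ.+ z) (volt-pot n (f b) (trans (type-f b) e)) ⟩
          v b ℤ.+ pot (f b)                                   ≡⟨ pot-f b _ e ⟩
          pot b                                               ∎

        -- Equal labels are of the same kind and have the same contents.
        label-injective : ∀ x y t t′ → label′ x t ≡ label′ y t′ →
                          (∃ λ c → t ≡ inj₁ c × t′ ≡ inj₁ c) ⊎
                          (∃ λ c → t ≡ inj₂ c × t′ ≡ inj₂ c ×
                             proj₁ x ⊕ pot (proj₂ x) ≡ proj₁ y ⊕ pot (proj₂ y))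
        label-injective x y (inj₁ c) (inj₁ d) e =
          inj₁ (c , refl , cong inj₁ (sym (Fin.↑ˡ-injective _ c d e)))
        label-injective x y (inj₁ c) (inj₂ d) e with
          trans (sym (Fin.splitAt-↑ˡ p c (m * q))) (trans (cong (splitAt p) e) (Fin.splitAt-↑ʳ p (m * q) _))
        ... | ()
        label-injective x y (inj₂ c) (inj₁ d) e with
          trans (sym (Fin.splitAt-↑ˡ p d (m * q))) (trans (cong (splitAt p) (sym e)) (Fin.splitAt-↑ʳ p (m * q) _))
        ... | ()
        label-injective x y (inj₂ c) (inj₂ d) e with
          Fin.combine-injective _ c _ d (Fin.↑ʳ-injective p _ _ e)
        ... | e₁ , refl = inj₂ (c , refl , refl , e₁)

        toRep-lift : ∀ j b → ∃ λ n → iterate lift (j , b) n ≡ (j ⊕ volt b (proj₁ (toRep b)) , rep (type b))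
        toRep-lift j b = let n , e = toRep b in
          n , trans (iterate-lift j b n) (cong (j ⊕ volt b n ,_) e)

        -- The point from which the way from the representative to b leads to (j , b).
        origin : Fin m → B → Fin m
        origin j b = j ⊕ ℤ.- volt (rep (type b)) (proj₁ (fromRep b))

        fromRep-lift : ∀ j b → ∃ λ n → iterate lift (origin j b , rep (type b)) n ≡ (j , b)
        fromRep-lift j b = let n , e = fromRep b; V = volt (rep (type b)) n in
          n , trans (iterate-lift _ _ n) (cong₂ _,_
            (trans (⊕-+ j (ℤ.- V) V) (trans (cong (j ⊕_) (ℤ.+-inverseˡ V)) (⊕-0 j))) e)

        path : ∀ {x y z} → (∃ λ n → iterate lift x n ≡ y) → (∃ λ n → iterate lift y n ≡ z) →
               ∃ λ n → iterate lift x n ≡ z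
        path {x} (n , refl) (n′ , refl) = n + n′ , iterate-+ lift x n n′

        -- Around an orbit of unit net voltage, all points of a fibre are reached.
        mid : ∀ {j j′ c t} → t ≡ inj₁ c → ∃ λ n → iterate lift (j , rep t) n ≡ (j′ , rep t)
        mid {j} {j′} {c} refl = let L , e , u = loop c; a , e′ = unit-transitive u j j′ in
          a * L , trans (iterate-loop e refl a j) (cong (_, rep (inj₁ c)) e′)

        volt-toRep : ∀ b {c} → type b ≡ inj₂ c → volt b (proj₁ (toRep b)) ≡ pot b
        volt-toRep b {c} e = begin
          volt b n                              ≡⟨ ℤ.+-identityʳ _ ⟨
          volt b n ℤ.+ + 0                      ≡⟨ cong (λ z → volt b n ℤ.+ z) (pot-rep c) ⟨
          volt b n ℤ.+ pot (rep (inj₂ c))       ≡⟨ cong (λ t → volt b n ℤ.+ pot (rep t)) e ⟨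
          volt b n ℤ.+ pot (rep (type b))       ≡⟨ cong (λ t → volt b n ℤ.+ pot t) (proj₂ (toRep b)) ⟨
          volt b n ℤ.+ pot (iterate f b n)      ≡⟨ volt-pot n b e ⟩
          pot b                                 ∎
          where n = proj₁ (toRep b)

        volt-fromRep : ∀ b {c} → type b ≡ inj₂ c →
                       ℤ.- volt (rep (type b)) (proj₁ (fromRep b)) ≡ pot b
        volt-fromRep b {c} e = begin
          ℤ.- V                        ≡⟨ lemma V (pot b) ⟩
          pot b ℤ.- (V ℤ.+ pot b)      ≡⟨ cong (λ z → pot b ℤ.- (V ℤ.+ pot z)) (proj₂ (fromRep b)) ⟨
          pot b ℤ.- (V ℤ.+ pot (iterate f (rep (type b)) n))
                                       ≡⟨ cong (λ z → pot b ℤ.- z) (volt-pot n (rep (type b)) (trans (type-rep _) e)) ⟩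
          pot b ℤ.- pot (rep (type b)) ≡⟨ cong (λ t → pot b ℤ.- pot (rep t)) e ⟩
          pot b ℤ.- pot (rep (inj₂ c)) ≡⟨ cong (λ z → pot b ℤ.- z) (pot-rep c) ⟩
          pot b ℤ.- + 0                ≡⟨ ℤ.+-identityʳ (pot b) ⟩
          pot b                        ∎
          where
          n = proj₁ (fromRep b)
          V = volt (rep (type b)) n
          lemma : ∀ x y → ℤ.- x ≡ y ℤ.- (x ℤ.+ y)
          lemma = ℤ.solve-∀

        connect : ∀ x y → label x ≡ label y → ∃ λ n → iterate lift x n ≡ y
        connect (j , b) (j′ , b′) e
          with label-injective (j , b) (j′ , b′) (type b) (type b′) e
        ... | inj₁ (c , e₁ , e₂) =
          path (toRep-lift j b) (path around (fromRep-lift j′ b′))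
          where
          j₀ = j ⊕ volt b (proj₁ (toRep b))
          around : ∃ λ n → iterate lift (j₀ , rep (type b)) n ≡ (origin j′ b′ , rep (type b′))
          around = subst (λ t → ∃ λ n → iterate lift (j₀ , rep (type b)) n ≡ (origin j′ b′ , rep t))
                     (trans e₁ (sym e₂)) (mid e₁)
        ... | inj₂ (c , e₁ , e₂ , e₃) =
          path (toRep-lift j b) (path (0 , stay) (fromRep-lift j′ b′))
          where
          stay : (j ⊕ volt b (proj₁ (toRep b)) , rep (type b)) ≡ (origin j′ b′ , rep (type b′))
          stay = cong₂ (λ i t → i , rep t)
            (trans (cong (j ⊕_) (volt-toRep b e₁))
              (trans e₃ (cong (j′ ⊕_) (sym (volt-fromRep b′ e₂)))))
            (trans e₁ (sym e₂))

        label-onto : ∀ t → ∃ λ x → label x ≡ join p (m * q) t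
        label-onto (inj₁ c) = (zero , rep (inj₁ c)) , cong (label′ _) (type-rep (inj₁ c))
        label-onto (inj₂ d) = let j , c = remQuot {m} q d in
          (j , rep (inj₂ c)) ,
          trans (cong (label′ _) (type-rep (inj₂ c)))
            (cong (p ↑ʳ_) (trans (cong (λ z → combine z c) (trans (cong (j ⊕_) (pot-rep c)) (⊕-0 j)))
              (Fin.combine-remQuot {m} q d)))

      orbits : Orbits lift (p + m * q)
      orbits = record
        { orbit = label
        ; onto  = λ c → let x , e = label-onto (splitAt p c) in
                        x , trans e (Fin.join-splitAt p (m * q) c)
        ; same  = λ x y → mk⇔ (connect x y) λ { (n , refl) → sym (label-iterate n x) }
        }

-- The cube

-- The dart (x , k) of the cube leaves the vertex x in direction k.  The vertices
-- 0F to 3F are t₀ to t₃ and 4F to 7F are b₀ to b₃.  Direction 0F leads to the next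
-- vertex in the cycle t or b, direction 1F to the previous one, and direction 2F along
-- an edge between tₖ and b₃₋ₖ.
--
-- In a drawing of a ladder, t₀ to t₃ are at the top from left to right, and b₀ to b₃
-- at the bottom from right to left.  So the directions 0F, 1F, 2F are in
-- counterclockwise order at each vertex.
CubeDart : Set
CubeDart = Fin 8 × Fin 3

_≟ᵈ_ : DecidableEquality CubeDart
_≟ᵈ_ = Product.≡-dec Fin._≟_ Fin._≟_

target : Fin 8 → Fin 3 → Fin 8
target x 0F = lookup (1F ∷ 2F ∷ 3F ∷ 0F ∷ 5F ∷ 6F ∷ 7F ∷ 4F ∷ []) x
target x 1F = lookup (3F ∷ 0F ∷ 1F ∷ 2F ∷ 7F ∷ 4F ∷ 5F ∷ 6F ∷ []) x
target x 2F = lookup (7F ∷ 6F ∷ 5F ∷ 4F ∷ 3F ∷ 2F ∷ 1F ∷ 0F ∷ []) x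

reverse : Fin 3 → Fin 3
reverse 0F = 1F
reverse 1F = 0F
reverse 2F = 2F

turn : Fin 3 → Fin 3
turn 0F = 1F
turn 1F = 2F
turn 2F = 0F

-- The number of the ladder increases from t₃ to t₀ and from b₃ to b₀.
voltage : CubeDart → ℤ
voltage (3F , 0F) = + 1
voltage (7F , 0F) = + 1
voltage (0F , 1F) = -[1+ 0 ]
voltage (4F , 1F) = -[1+ 0 ]
voltage _         = + 0

-- The opposite dart, the rotation and the face permutation of the cube.
opp₀ σ₀ φ₀ : CubeDart → CubeDart
opp₀ (x , k) = target x k , reverse k
σ₀ (x , k) = x , turn k
φ₀ = σ₀ ∘ opp₀

no-voltage : {B : Set} → B → ℤ
no-voltage _ = + 0

σ-orbits : BaseOrbits σ₀ no-voltage 0 8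
σ-orbits = baseOrbits _≟ᵈ_ σ₀ no-voltage (inj₂ ∘ proj₁) (λ { (inj₂ x) → x , 0F }) no-voltage tt

-- The edges of the cycles t and b are numbered by their starting points, and
-- 8 to 11 are the edges at t₀ to t₃ between the cycles.
cubeEdge : CubeDart → Fin 12
cubeEdge (x , 0F) = x ↑ˡ 4
cubeEdge (x , 1F) = target x 1F ↑ˡ 4
cubeEdge (x , 2F) = 8 ↑ʳ lookup (0F ∷ 1F ∷ 2F ∷ 3F ∷ 3F ∷ 2F ∷ 1F ∷ 0F ∷ []) x

edgeRep : Fin 12 → CubeDart
edgeRep e = lookup
  ( (0F , 0F) ∷ (1F , 0F) ∷ (2F , 0F) ∷ (3F , 0F) ∷ (4F , 0F) ∷ (5F , 0F) ∷ (6F , 0F) ∷ (7F , 0F)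
  ∷ (0F , 2F) ∷ (1F , 2F) ∷ (2F , 2F) ∷ (3F , 2F) ∷ []) e

-- An edge of a cover lies in the ladder of the dart in direction 0F, whose
-- representative is in `edgeRep`.
backward : CubeDart → ℤ
backward (x , 1F) = voltage (x , 1F)
backward _ = + 0

opp-orbits : BaseOrbits opp₀ voltage 0 12
opp-orbits = baseOrbits _≟ᵈ_ opp₀ voltage (inj₂ ∘ cubeEdge) (λ { (inj₂ e) → edgeRep e }) backward tt

-- The face to the right of a dart.  The faces inj₁ 1F and inj₁ 2F are t and b, the
-- faces inj₂ 0F to inj₂ 2F are the squares of a ladder from left to right, and
-- inj₁ 0F is the face between two ladders.
cubeFace : CubeDart → Fin 3 ⊎ Fin 3
cubeFace (x , 0F) = lookup (inj₂ 0F ∷ inj₂ 1F ∷ inj₂ 2F ∷ inj₁ 0F ∷ inj₂ 2F ∷ inj₂ 1F ∷ inj₂ 0F ∷ inj₁ 0F ∷ []) x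
cubeFace (x , 1F) = lookup (inj₁ 1F ∷ inj₁ 1F ∷ inj₁ 1F ∷ inj₁ 1F ∷ inj₁ 2F ∷ inj₁ 2F ∷ inj₁ 2F ∷ inj₁ 2F ∷ []) x
cubeFace (x , 2F) = lookup (inj₁ 0F ∷ inj₂ 0F ∷ inj₂ 1F ∷ inj₂ 2F ∷ inj₁ 0F ∷ inj₂ 2F ∷ inj₂ 1F ∷ inj₂ 0F ∷ []) x

faceRep : Fin 3 ⊎ Fin 3 → CubeDart
faceRep (inj₁ 0F) = 3F , 0F
faceRep (inj₁ 1F) = 0F , 1F
faceRep (inj₁ 2F) = 4F , 1F
faceRep (inj₂ 0F) = 0F , 0F
faceRep (inj₂ 1F) = 1F , 0F
faceRep (inj₂ 2F) = 2F , 0F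

φ-orbits : BaseOrbits φ₀ voltage 3 3
φ-orbits = baseOrbits _≟ᵈ_ φ₀ voltage cubeFace faceRep no-voltage tt

-- The cube with two edges cut

-- In the cutout, the edges t₁ t₂ and b₁ b₂ of each ladder are cut.  The ends of the
-- resulting arcs are the darts and four points for each ladder: 0F and 1F are on the
-- side at the right half of the ladder, on the arcs from b₁ and t₂; 2F and 3F are on
-- the side at the left half, on the arcs from t₁ and b₂.
End₀ : Set
End₀ = CubeDart ⊎ Fin 4

_≟ᵉ_ : DecidableEquality End₀
_≟ᵉ_ = Sum.≡-dec _≟ᵈ_ Fin._≟_

arc₀ : End₀ → End₀
arc₀ (inj₁ (1F , 0F)) = inj₂ 2F
arc₀ (inj₁ (5F , 0F)) = inj₂ 0F
arc₀ (inj₁ (2F , 1F)) = inj₂ 1F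
arc₀ (inj₁ (6F , 1F)) = inj₂ 3F
arc₀ (inj₁ d)         = inj₁ (opp₀ d)
arc₀ (inj₂ 0F)        = inj₁ (5F , 0F)
arc₀ (inj₂ 1F)        = inj₁ (2F , 1F)
arc₀ (inj₂ 2F)        = inj₁ (1F , 0F)
arc₀ (inj₂ 3F)        = inj₁ (6F , 1F)

arcVoltage : End₀ → ℤ
arcVoltage (inj₁ d) = voltage d
arcVoltage (inj₂ _) = + 0

-- The rotation, in which the points are ordered clockwise along the polygon.
-- After the right half of a ladder comes the left half of the next ladder, and then
-- the right half of the ladder after that.
spin₀ : End₀ → End₀
spin₀ (inj₁ d) = inj₁ (σ₀ d)
spin₀ (inj₂ 0F) = inj₂ 1F
spin₀ (inj₂ 1F) = inj₂ 2F
spin₀ (inj₂ 2F) = inj₂ 3F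
spin₀ (inj₂ 3F) = inj₂ 0F

-- From the right half to the next left half, and from there to the next right half.
spinVoltage : End₀ → ℤ
spinVoltage (inj₂ 1F) = + 1
spinVoltage (inj₂ 3F) = + 1
spinVoltage _         = + 0

spin-orbits : BaseOrbits spin₀ spinVoltage 1 8
spin-orbits = baseOrbits _≟ᵉ_ spin₀ spinVoltage
  (λ { (inj₁ (x , _)) → inj₂ x ; (inj₂ _) → inj₁ 0F })
  (λ { (inj₁ _) → inj₂ 0F ; (inj₂ x) → inj₁ (x , 0F) }) no-voltage tt

-- An arc which is part of a cut edge t₁ t₂ or b₁ b₂ has the number of the edge if
-- it contains t₁ or b₁, and otherwise the number 12 or 13.
arcEdge : End₀ → Fin 14
arcEdge (inj₁ (2F , 1F)) = 12 ↑ʳ 0F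
arcEdge (inj₁ (6F , 1F)) = 12 ↑ʳ 1F
arcEdge (inj₁ d)         = cubeEdge d ↑ˡ 2
arcEdge (inj₂ 0F)        = 5F
arcEdge (inj₂ 1F)        = 12 ↑ʳ 0F
arcEdge (inj₂ 2F)        = 1F
arcEdge (inj₂ 3F)        = 12 ↑ʳ 1F

arcRep : Fin 14 → End₀
arcRep e = [ inj₁ ∘ edgeRep , (λ { 0F → inj₂ 1F ; 1F → inj₂ 3F }) ]′ (Fin.splitAt 12 e)

arc-orbits : BaseOrbits arc₀ arcVoltage 0 14
arc-orbits = baseOrbits _≟ᵉ_ arc₀ arcVoltage (inj₂ ∘ arcEdge) (λ { (inj₂ e) → arcRep e })
  ([ backward , no-voltage ]′) tt

ψ₀ : End₀ → End₀
ψ₀ = spin₀ ∘ arc₀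

ψVoltage : End₀ → ℤ
ψVoltage e = arcVoltage e ℤ.+ spinVoltage (arc₀ e)

-- The regions of the polygon.  inj₁ 0F is the face between the ladders; for each
-- ladder, there are the left and the right square, the left and the right half of the
-- middle square, and the pieces of the faces t and b adjacent to the point on the arc
-- from t₁ or b₁.
regionType : End₀ → Fin 1 ⊎ Fin 6
regionType (inj₁ (1F , 0F)) = inj₂ 2F
regionType (inj₁ (6F , 2F)) = inj₂ 2F
regionType (inj₂ 3F)        = inj₂ 2F
regionType (inj₁ (5F , 0F)) = inj₂ 3F
regionType (inj₁ (2F , 2F)) = inj₂ 3F
regionType (inj₂ 1F)        = inj₂ 3F
regionType (inj₂ 2F)        = inj₂ 4F
regionType (inj₂ 0F)        = inj₂ 5F
regionType (inj₁ d) with cubeFace d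
... | inj₁ 0F = inj₁ 0F
... | inj₁ 1F = inj₂ 4F
... | inj₁ 2F = inj₂ 5F
... | inj₂ 0F = inj₂ 0F
-- The darts of the middle square have been dealt with above.
... | inj₂ 1F = inj₂ 0F
... | inj₂ 2F = inj₂ 1F

regionRep : Fin 1 ⊎ Fin 6 → End₀
regionRep (inj₁ _)  = inj₁ (3F , 0F)
regionRep (inj₂ 0F) = inj₁ (0F , 0F)
regionRep (inj₂ 1F) = inj₁ (2F , 0F)
regionRep (inj₂ 2F) = inj₂ 3F
regionRep (inj₂ 3F) = inj₂ 1F
regionRep (inj₂ 4F) = inj₂ 2F
regionRep (inj₂ 5F) = inj₂ 0F

-- A piece of the face t or b extends from the ladder of its representative to
-- vertices of the preceding ladder.
regionPot : End₀ → ℤ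
regionPot (inj₁ (2F , 1F)) = + 1
regionPot (inj₁ (3F , 1F)) = + 1
regionPot (inj₁ (6F , 1F)) = + 1
regionPot (inj₁ (7F , 1F)) = + 1
regionPot _                = + 0

ψ-orbits : BaseOrbits ψ₀ ψVoltage 1 6
ψ-orbits = baseOrbits _≟ᵉ_ ψ₀ ψVoltage regionType regionRep regionPot tt

-- Face walks in one ladder, for an arbitrary rotation

-- The two cyclic orders of the directions at a vertex.
pivot : Bool → Fin 3 → Fin 3
pivot true  = turn
pivot false = turn ∘ turn

-- The rotation of a ladder in which the vertex x has the cyclic order w x.
pivotAt : Vec Bool 8 → CubeDart → CubeDart
pivotAt w (x , k) = x , pivot (lookup w x) k

-- Five triples of darts, one of which is suitable for each rotation of a ladder, as
-- is verified in `stops-exist`.  No other property of these triples matters.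
stops : Fin 5 → Fin 3 → CubeDart
stops 0F = lookup ((0F , 1F) ∷ (2F , 0F) ∷ (5F , 1F) ∷ [])
stops 1F = lookup ((0F , 0F) ∷ (5F , 2F) ∷ (6F , 2F) ∷ [])
stops 2F = lookup ((1F , 1F) ∷ (1F , 2F) ∷ (2F , 2F) ∷ [])
stops 3F = lookup ((0F , 1F) ∷ (1F , 0F) ∷ (6F , 1F) ∷ [])
stops 4F = lookup ((2F , 2F) ∷ (4F , 0F) ∷ (6F , 1F) ∷ [])

-- good n d: within n steps, the face walk from d meets the triple t or leaves the
-- ladder.  It may leave to the preceding ladder only if down is true.
module _ (t : Fin 5) (w : Vec Bool 8) (down : Bool) where
  mutual
    good : ℕ → CubeDart → Bool
    good n d = isYes (Fin.any? λ s → stops t s ≟ᵈ d) ∨ leaves n d (voltage d)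

    leaves : ℕ → CubeDart → ℤ → Bool
    leaves _       d (+ suc _)  = true
    leaves _       d (-[1+ _ ]) = down
    leaves zero    d (+ zero)   = false
    leaves (suc n) d (+ zero)   = good n (pivotAt w (opp₀ d))

-- The darts that lead to the following and to the preceding ladder.
ups downs : Fin 2 → CubeDart
ups 0F = 3F , 0F
ups 1F = 7F , 0F
downs 0F = 0F , 1F
downs 1F = 4F , 1F

exits : ∀ d → voltage d ≡ + 0 ⊎ (∃ λ e → ups e ≡ d) ⊎ (∃ λ e → downs e ≡ d)
exits = from-yes (every? λ d → (voltage d ℤ.≟ + 0) ⊎-dec
  Fin.any? (λ e → ups e ≟ᵈ d) ⊎-dec Fin.any? (λ e → downs e ≟ᵈ d))

-- A ladder has 24 darts, so that 24 steps suffice.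
abstract
  Good : Fin 5 → Vec Bool 8 → Bool → CubeDart → Set
  Good t w down d = T (good t w down 24 d)

  stops-exist : ∀ w → ∃ λ t → (∀ d → Good t w true d) × (∀ e → Good t w false (pivotAt w (downs e)))
  stops-exist = from-yes (every? λ w → Fin.any? λ t →
    every? (λ d → T? (good t w true 24 d)) ×-dec
    every? (λ e → T? (good t w false 24 (pivotAt w (downs e)))))

module _ (t : Fin 5) (w : Vec Bool 8) (down : Bool) (H : CubeDart → Set)
         (stop : ∀ s → H (stops t s))
         (step : ∀ d → voltage d ≡ + 0 → H (pivotAt w (opp₀ d)) → H d)
         (up   : ∀ e → H (ups e))
         (dn   : T down → ∀ e → H (downs e)) where

  private
    good-induction : ∀ n d → T (good t w down n d) → H d
    leaves-induction : ∀ n d → voltage d ≡ + 0 → T (leaves t w down n d (+ 0)) → H d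

    good-induction n d ok with Equivalence.to (T-∨ {isYes (Fin.any? λ s → stops t s ≟ᵈ d)}) ok
    ... | inj₁ h = let s , e = toWitness h in subst H e (stop s)
    ... | inj₂ h with exits d
    ...   | inj₁ e = leaves-induction n d e (subst (λ z → T (leaves t w down n d z)) e h)
    ...   | inj₂ (inj₁ (e , refl))  = up e
    ...   | inj₂ (inj₂ (0F , refl)) = dn h 0F
    ...   | inj₂ (inj₂ (1F , refl)) = dn h 1F

    leaves-induction (suc n) d e h = step d e (good-induction n (pivotAt w (opp₀ d)) h)

  abstract
    -- A property which holds at the triple and at the exits, and is inherited backwards
    -- along face walks inside the ladder, holds at every good dart.
    good-sound : ∀ d → Good t w down d → H d
    good-sound = good-induction 24

-- Properties of the cube

opp₀-involutive : ∀ d → opp₀ (opp₀ d) ≡ d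
opp₀-involutive = from-yes (every? λ d → opp₀ (opp₀ d) ≟ᵈ d)

voltage-opp₀ : ∀ d → voltage d ℤ.+ voltage (opp₀ d) ≡ + 0
voltage-opp₀ = from-yes (every? λ d → voltage d ℤ.+ voltage (opp₀ d) ℤ.≟ + 0)

target-injective : ∀ x k k′ → target x k ≡ target x k′ → k ≡ k′
target-injective = from-yes (every? λ x → every? λ k → every? λ k′ →
  (target x k Fin.≟ target x k′) →-dec (k Fin.≟ k′))

target-irrefl : ∀ x k → target x k ≢ x
target-irrefl = from-yes (every? λ x → every? λ k → ¬? (target x k Fin.≟ x))

-- The net voltage around a face of the cube.
net : Fin 3 ⊎ Fin 3 → ℤ
net (inj₁ 0F) = + 2
net (inj₁ _)  = -[1+ 0 ]
net (inj₂ _)  = + 0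

φ₀-loop : ∀ d → iterate φ₀ d 4 ≡ d
φ₀-loop = from-yes (every? λ d → iterate φ₀ d 4 ≟ᵈ d)

φ₀-injective : ∀ d (r r′ : Fin 4) → iterate φ₀ d (toℕ r) ≡ iterate φ₀ d (toℕ r′) → r ≡ r′
φ₀-injective = from-yes (every? λ d → every? λ (r : Fin 4) → every? λ (r′ : Fin 4) →
  (iterate φ₀ d (toℕ r) ≟ᵈ iterate φ₀ d (toℕ r′)) →-dec (r Fin.≟ r′))

-- The three faces at a vertex are different.
cubeFace-injective : ∀ x k k′ → cubeFace (x , k) ≡ cubeFace (x , k′) → k ≡ k′
cubeFace-injective = from-yes (every? λ x → every? λ k → every? λ k′ →
  (Sum.≡-dec Fin._≟_ Fin._≟_ (cubeFace (x , k)) (cubeFace (x , k′))) →-dec (k Fin.≟ k′))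

cubeFace-iterate : ∀ n d → cubeFace (iterate φ₀ d n) ≡ cubeFace d
cubeFace-iterate zero    d = refl
cubeFace-iterate (suc n) d = trans (cubeFace-iterate n (φ₀ d)) (BaseOrbits.type-f φ-orbits d)

-- The graph and its rotation

module Construction (i : ℕ) where

  open Cyclic (2 * i) public

  -- The darts of G in coordinates: the dart (j , b) is over b, in the ladder j.
  Cell : Set
  Cell = Fin m × CubeDart

  -- The vertices of G in coordinates.  Only the two inverse laws are used below.
  abstract
    vertex : Fin m → Fin 8 → Fin (m * 8)
    vertex = combine

    coordinates : Fin (m * 8) → Fin m × Fin 8
    coordinates = remQuot {m} 8

    coordinates-vertex : ∀ j x → coordinates (vertex j x) ≡ (j , x)
    coordinates-vertex = Fin.remQuot-combine {m} {8}

    vertex-coordinates : ∀ u → uncurry vertex (coordinates u) ≡ u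
    vertex-coordinates = Fin.combine-remQuot {m} 8

  vertex-injective : ∀ {j x j′ x′} → vertex j x ≡ vertex j′ x′ → (j , x) ≡ (j′ , x′)
  vertex-injective e =
    trans (sym (coordinates-vertex _ _)) (trans (cong coordinates e) (coordinates-vertex _ _))

  -- The neighbour of u in direction k.
  nbr : Fin (m * 8) → Fin 3 → Fin (m * 8)
  nbr u k = let j , x = coordinates u in vertex (j ⊕ voltage (x , k)) (target x k)

  nbr-vertex : ∀ j x k → nbr (vertex j x) k ≡ vertex (j ⊕ voltage (x , k)) (target x k)
  nbr-vertex j x k =
    cong (λ (j , x) → vertex (j ⊕ voltage (x , k)) (target x k)) (coordinates-vertex j x)

  by-coordinates : (P : Fin (m * 8) → Set) → (∀ j x → P (vertex j x)) → ∀ u → P u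
  by-coordinates P h u = subst P (vertex-coordinates u) (uncurry h (coordinates u))

  nbr-injective : ∀ u {k k′} → nbr u k ≡ nbr u k′ → k ≡ k′
  nbr-injective u {k} {k′} e = target-injective (proj₂ (coordinates u)) k k′ (cong proj₂ (vertex-injective e))

  nbr-reverse : ∀ u k → nbr (nbr u k) (reverse k) ≡ u
  nbr-reverse = by-coordinates (λ u → ∀ k → nbr (nbr u k) (reverse k) ≡ u) λ j x k → begin
    nbr (nbr (vertex j x) k) (reverse k)
      ≡⟨ cong (λ u → nbr u (reverse k)) (nbr-vertex j x k) ⟩
    nbr (vertex (j ⊕ voltage (x , k)) (target x k)) (reverse k)
      ≡⟨ nbr-vertex (j ⊕ voltage (x , k)) (target x k) (reverse k) ⟩
    vertex (j ⊕ voltage (x , k) ⊕ voltage (opp₀ (x , k))) (proj₁ (opp₀ (opp₀ (x , k))))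
      ≡⟨ cong₂ vertex (trans (⊕-+ j (voltage (x , k)) (voltage (opp₀ (x , k)))) (trans (cong (j ⊕_) (voltage-opp₀ (x , k))) (⊕-0 j)))
           (cong proj₁ (opp₀-involutive (x , k))) ⟩
    vertex j x ∎

  G : Graph (m * 8)
  G = record
    { _~_      = λ u w → ∃ λ k → nbr u k ≡ w
    ; _~?_     = λ u w → Fin.any? λ k → nbr u k Fin.≟ w
    ; ~-sym    = λ { {u} (k , refl) → reverse k , nbr-reverse u k }
    ; ~-irrefl = λ { {u} refl (k , e) → irrefl u k e }
    }
    where
    irrefl : ∀ u k → nbr u k ≢ u
    irrefl = by-coordinates (λ u → ∀ k → nbr u k ≢ u) λ j x k e → target-irrefl x k
      (cong proj₂ (vertex-injective (trans (sym (nbr-vertex j x k)) e)))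

  open Graph G public

  dart-≡ : ∀ {d d′ : Dart G} → src d ≡ src d′ → tgt d ≡ tgt d′ → d ≡ d′
  dart-≡ {dart _ _ _} {dart _ _ _} refl refl = refl

  -- The adjacency proof in a dart is irrelevant, but adjacency is decidable, so that
  -- the direction can be recovered.
  abstract
    direction : (d : Dart G) → ∃ λ k → nbr (src d) k ≡ tgt d
    direction (dart u w e) = recompute (u ~? w) e

  cell : Dart G → Cell
  cell d = let j , x = coordinates (src d) in j , x , proj₁ (direction d)

  vertexOf : Cell → Fin (m * 8)
  vertexOf (j , x , _) = vertex j x

  fromCell : Cell → Dart G
  fromCell (j , x , k) = dart (vertex j x) (nbr (vertex j x) k) (k , refl)

  src-cell : ∀ d → src d ≡ vertexOf (cell d)
  src-cell d = sym (vertex-coordinates (src d))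

  fromCell-cell : ∀ d → fromCell (cell d) ≡ d
  fromCell-cell d = dart-≡ (sym (src-cell d))
    (trans (cong (λ u → nbr u (proj₁ r)) (sym (src-cell d))) (proj₂ r))
    where r = direction d

  cell-fromCell : ∀ c → cell (fromCell c) ≡ c
  cell-fromCell (j , x , k) =
    cong₂ (λ (j , x) k → j , x , k) (coordinates-vertex j x)
      (nbr-injective (vertex j x) (proj₂ (direction (fromCell (j , x , k)))))

  by-cells : (P : Dart G → Set) → (∀ c → P (fromCell c)) → ∀ d → P d
  by-cells P h d = subst P (fromCell-cell d) (h (cell d))

  cell-injective : ∀ {d d′} → cell d ≡ cell d′ → d ≡ d′
  cell-injective {d} {d′} e = trans (sym (fromCell-cell d)) (trans (cong fromCell e) (fromCell-cell d′))

  module Opp = Cover opp₀ voltage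
  module Sigma = Cover σ₀ no-voltage
  module Φ = Cover φ₀ voltage

  opp-fromCell : ∀ c → opp G (fromCell c) ≡ fromCell (Opp.lift c)
  opp-fromCell (j , x , k) = dart-≡ (nbr-vertex j x k)
    (trans (sym (nbr-reverse (vertex j x) k)) (cong (λ u → nbr u (reverse k)) (nbr-vertex j x k)))

  cell-opp : ∀ d → cell (opp G d) ≡ Opp.lift (cell d)
  cell-opp d = begin
    cell (opp G d)                    ≡⟨ cong (cell ∘ opp G) (fromCell-cell d) ⟨
    cell (opp G (fromCell (cell d)))  ≡⟨ cong cell (opp-fromCell (cell d)) ⟩
    cell (fromCell (Opp.lift (cell d))) ≡⟨ cell-fromCell _ ⟩
    Opp.lift (cell d)                 ∎

  edgeOrbits : Orbits (opp G) (m * 12)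
  edgeOrbits = transfer cell fromCell fromCell-cell cell-fromCell cell-opp (Opp.orbits opp-orbits λ ())

  σ : Dart G → Dart G
  σ d = fromCell (Sigma.lift (cell d))

  cell-σ : ∀ d → cell (σ d) ≡ Sigma.lift (cell d)
  cell-σ d = cell-fromCell _

  vertexOrbits : Orbits σ (m * 8)
  vertexOrbits = transfer cell fromCell fromCell-cell cell-fromCell cell-σ (Sigma.orbits σ-orbits λ ())

  R : Rotation G
  R = record
    { σ        = σ
    ; σ-src    = λ { d@(dart u _ _) → trans
        (cong (λ j → vertex j (proj₂ (coordinates u))) (⊕-0 (proj₁ (coordinates u)))) (sym (src-cell d)) }
    ; σ-cyclic = λ { d@(dart u _ _) d′@(dart _ _ _) refl → Equivalence.to (Orbits.same vertexOrbits d d′) refl }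
    }

  open Rotation R using (φ) public

  cell-φ : ∀ d → cell (φ d) ≡ Φ.lift (cell d)
  cell-φ d = trans (cell-σ (opp G d)) (trans (cong Sigma.lift (cell-opp d)) (cong (_, Φ-local) (⊕-0 _)))
    where Φ-local = φ₀ (proj₂ (cell d))

  cell-iterate-φ : ∀ d n → cell (iterate φ d n) ≡
    (proj₁ (cell d) ⊕ Φ.volt (proj₂ (cell d)) n , iterate φ₀ (proj₂ (cell d)) n)
  cell-iterate-φ d n = trans (iterate-semiconj cell cell-φ d n) (Φ.iterate-lift (proj₁ (cell d)) (proj₂ (cell d)) n)

  -- As m is odd, 2 is a unit.
  unit-net : ∀ c → Unit (net (inj₁ c))
  unit-net 0F = unit-2 {i} refl
  unit-net 1F = unit-negative-one
  unit-net 2F = unit-negative-one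

  faceOrbits : Orbits φ (3 + m * 3)
  faceOrbits = transfer cell fromCell fromCell-cell cell-fromCell cell-φ
    (Φ.orbits φ-orbits λ { 0F → 4 , refl , unit-net 0F ; 1F → 4 , refl , unit-net 1F ; 2F → 4 , refl , unit-net 2F })

-- Bounds for the number of orbits

orbit-cyclic : {A : Set} {f : A → A} {x : A} (n : ℕ) → f (f x) ≡ x → iterate f x n ≡ x ⊎ iterate f x n ≡ f x
orbit-cyclic zero          e = inj₁ refl
orbit-cyclic (suc zero)    e = inj₂ refl
orbit-cyclic {f = f} (suc (suc n)) e rewrite e = orbit-cyclic n e

third : ∀ (a b : Fin 3) → ∃ λ c → a ≢ c × b ≢ c
third = from-yes (every? λ (a : Fin 3) → every? λ (b : Fin 3) → Fin.any? λ c → ¬? (a Fin.≟ c) ×-dec ¬? (b Fin.≟ c))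

-- A function on Fin 3, given by its values a b c, without fixed points and without
-- transpositions is one of the two cyclic rotations.
pivot-table : ∀ (a b c : Fin 3) → a ≢ 0F → b ≢ 1F → c ≢ 2F →
  (a ≡ 1F → b ≢ 0F) → (a ≡ 2F → c ≢ 0F) → (b ≡ 2F → c ≢ 1F) →
  (∀ k → lookup (a ∷ b ∷ c ∷ []) k ≡ pivot true k) ⊎ (∀ k → lookup (a ∷ b ∷ c ∷ []) k ≡ pivot false k)
pivot-table = from-yes (every? λ a → every? λ b → every? λ c →
  ¬? (a Fin.≟ 0F) →-dec ¬? (b Fin.≟ 1F) →-dec ¬? (c Fin.≟ 2F) →-dec
  ((a Fin.≟ 1F) →-dec ¬? (b Fin.≟ 0F)) →-dec ((a Fin.≟ 2F) →-dec ¬? (c Fin.≟ 0F)) →-dec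
  ((b Fin.≟ 2F) →-dec ¬? (c Fin.≟ 1F)) →-dec
  (every? (λ k → lookup (a ∷ b ∷ c ∷ []) k Fin.≟ pivot true k) ⊎-dec
   every? (λ k → lookup (a ∷ b ∷ c ∷ []) k Fin.≟ pivot false k)))

lookup-η : ∀ (s : Fin 3 → Fin 3) k → s k ≡ lookup (s 0F ∷ s 1F ∷ s 2F ∷ []) k
lookup-η s 0F = refl
lookup-η s 1F = refl
lookup-η s 2F = refl

-- If a point is fixed or transposed with another one, then a third point is never
-- reached from it.
abstract
  transitive⇒pivot : (s : Fin 3 → Fin 3) → (∀ k k′ → ∃ λ n → iterate s k n ≡ k′) →
                     ∃ λ β → ∀ k → s k ≡ pivot β k
  transitive⇒pivot s reach with pivot-table (s 0F) (s 1F) (s 2F)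
      (no-fix 0F) (no-fix 1F) (no-fix 2F) (no-swap 0F 1F) (no-swap 0F 2F) (no-swap 1F 2F)
    where
    no-swap : ∀ a b → s a ≡ b → s b ≢ a
    no-swap a b refl e with third a (s a)
    ... | c , a≢c , sa≢c with reach a c
    ... | n , refl with orbit-cyclic n e
    ... | inj₁ e′ = a≢c (sym e′)
    ... | inj₂ e′ = sa≢c (sym e′)
    no-fix : ∀ a → s a ≢ a
    no-fix a e = no-swap a a e e
  ... | inj₁ h = true  , λ k → trans (lookup-η s k) (h k)
  ... | inj₂ h = false , λ k → trans (lookup-η s k) (h k)

orbits-≤ : {A : Set} {f : A → A} {k l : ℕ} → Orbits f k → Orbits f l → k ≤ l
orbits-≤ {k = k} {l} O P = Fin.injective⇒≤ {f = λ c → P.orbit (rep c)} λ {c} {d} e →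
    trans (sym (proj₂ (O.onto c)))
      (trans (Equivalence.from (O.same _ _) (Equivalence.to (P.same _ _) e)) (proj₂ (O.onto d)))
  where
  module O = Orbits O
  module P = Orbits P
  rep = λ c → proj₁ (O.onto c)

-- If every orbit contains one of l given points, then there are at most l orbits.
hitting-≤ : {A : Set} {f : A → A} {k l : ℕ} → Orbits f k → (slot : Fin l → A) →
            (∀ x → ∃ λ n → ∃ λ s → iterate f x n ≡ slot s) → k ≤ l
hitting-≤ {f = f} O slot hits = Fin.injective⇒≤ {f = s} λ {c} {d} e →
    trans (same-slot c) (trans (cong (λ s → O.orbit (slot s)) e) (sym (same-slot d)))
  where
  module O = Orbits O
  rep = λ c → proj₁ (O.onto c)
  s = λ c → proj₁ (proj₂ (hits (rep c)))
  same-slot : ∀ c → c ≡ O.orbit (slot (s c))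
  same-slot c = trans (sym (proj₂ (O.onto c)))
    (Equivalence.from (O.same _ _) (proj₁ (hits (rep c)) , proj₂ (proj₂ (hits (rep c)))))

-- The lower bound for the genus

module LowerBound (i : ℕ) where
  open Construction i hiding (σ; R; φ; cell-σ)

  vertices-≤ : (S : Rotation G) → ∀ {V} → Orbits (Rotation.σ S) V → V ≤ m * 8
  vertices-≤ S O = Fin.injective⇒≤ {f = λ c → src (proj₁ (O.onto c))} λ {c} {d} e →
    trans (sym (proj₂ (O.onto c)))
      (trans (Equivalence.from (O.same _ _) (Rotation.σ-cyclic S _ _ e)) (proj₂ (O.onto d)))
    where module O = Orbits O

  module _ (S : Rotation G) where
    open Rotation S

    place : Cell → Fin m × Fin 8
    place (j , x , _) = j , x

    place-cell : ∀ d → place (cell d) ≡ coordinates (src d)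
    place-cell (dart u _ _) = refl

    -- The rotation S at the vertex x of the ladder j, as a function on directions.
    s : Fin m → Fin 8 → Fin 3 → Fin 3
    s j x k = proj₂ (proj₂ (cell (σ (fromCell (j , x , k)))))

    cell-σ : ∀ j x k → cell (σ (fromCell (j , x , k))) ≡ (j , x , s j x k)
    cell-σ j x k = cong (λ (j′ , x′) → j′ , x′ , s j x k)
      (trans (place-cell (σ (fromCell (j , x , k))))
        (trans (cong coordinates (σ-src (fromCell (j , x , k)))) (coordinates-vertex j x)))

    σ-fromCell : ∀ j x k → σ (fromCell (j , x , k)) ≡ fromCell (j , x , s j x k)
    σ-fromCell j x k = trans (sym (fromCell-cell _)) (cong fromCell (cell-σ j x k))

    s-transitive : ∀ j x k k′ → ∃ λ n → iterate (s j x) k n ≡ k′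
    s-transitive j x k k′ = let n , e = σ-cyclic (fromCell (j , x , k)) (fromCell (j , x , k′)) refl in
      n , cong (λ c → proj₂ (proj₂ c)) {x = j , x , iterate (s j x) k n}
        (trans (sym (cell-fromCell _)) (trans (cong cell
          (trans (iterate-semiconj (λ k → fromCell (j , x , k)) (λ k → sym (σ-fromCell j x k)) k n) e)) (cell-fromCell _)))

    bend : Fin m → Fin 8 → Bool
    bend j x = proj₁ (transitive⇒pivot (s j x) (s-transitive j x))

    -- The rotation of the ladder j.
    config : Fin m → Vec Bool 8
    config j = tabulate (bend j)

    cell-pivot : ∀ j d → cell (σ (fromCell (j , d))) ≡ (j , pivotAt (config j) d)
    cell-pivot j (x , k) = trans (cell-σ j x k) (cong (λ k → j , x , k)
      (trans (proj₂ (transitive⇒pivot (s j x) (s-transitive j x)) k)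
        (cong (λ β → pivot β k) (sym (lookup∘tabulate (bend j) x)))))

    -- The face permutation of S in coordinates.
    Φ′ : Cell → Cell
    Φ′ c = cell (φ (fromCell c))

    Φ-pivot : ∀ j d → Φ′ (j , d) ≡ (j ⊕ voltage d , pivotAt (config (j ⊕ voltage d)) (opp₀ d))
    Φ-pivot j d = trans (cong (cell ∘ σ) (opp-fromCell (j , d))) (cell-pivot (j ⊕ voltage d) (opp₀ d))

    last : Fin m
    last = fromℕ (2 * i)

    choice : Fin m → Fin 5
    choice j = proj₁ (stops-exist (config j))

    -- The selected darts: four darts across the cut, and three for each ladder.
    slot′ : (Fin 2 ⊎ Fin 2) ⊎ (Fin m × Fin 3) → Cell
    slot′ (inj₁ (inj₁ e)) = last , ups e
    slot′ (inj₁ (inj₂ e)) = zero , downs e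
    slot′ (inj₂ (j , s))  = j , stops (choice j) s

    Hits : Cell → Set
    Hits c = ∃ λ n → ∃ λ s → iterate Φ′ c n ≡ slot′ s

    hits-slot : ∀ {c} s → slot′ s ≡ c → Hits c
    hits-slot s e = 0 , s , sym e

    hits-step : ∀ {c c′} → Φ′ c ≡ c′ → Hits c′ → Hits c
    hits-step refl (n , s , e) = suc n , s , e

    within : ∀ j d → voltage d ≡ + 0 → Hits (j , pivotAt (config j) (opp₀ d)) → Hits (j , d)
    within j d e = hits-step (trans (Φ-pivot j d)
      (cong (λ j → j , pivotAt (config j) (opp₀ d)) (trans (cong (j ⊕_) e) (⊕-0 j))))

    -- A walk that proceeds to the following ladder hits a selected dart, by induction
    -- on the number n of ladders before the cut.
    climb : ∀ n j → n + toℕ j ≡ 2 * i → ∀ e → Hits (j , ups e)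
    climb zero j eq e = hits-slot (inj₁ (inj₁ e))
      (cong (_, ups e) (Fin.toℕ-injective (trans (Fin.toℕ-fromℕ _) (sym eq))))
    climb (suc n) j eq e = hits-step (step e) (good-sound (choice j′) (config j′) false (λ d → Hits (j′ , d))
      (λ s → hits-slot (inj₂ (j′ , s)) refl) (within j′) (climb n j′ eq′) (λ ()) (pivotAt (config j′) (downs e))
      (proj₂ (proj₂ (stops-exist (config j′))) e))
      where
      j′ = j ⊕ + 1
      step : ∀ e → Φ′ (j , ups e) ≡ (j′ , pivotAt (config j′) (downs e))
      step 0F = Φ-pivot j (ups 0F)
      step 1F = Φ-pivot j (ups 1F)
      eq′ : n + toℕ j′ ≡ 2 * i
      eq′ = trans (cong (λ z → n + z) (toℕ-⊕1 j (ℕ.≤-trans (s≤s (ℕ.m≤n+m (toℕ j) n)) (ℕ.≤-reflexive eq))))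
             (trans (ℕ.+-suc n (toℕ j)) eq)

    -- Every walk hits a selected dart.  If it leaves the ladder upwards, then `climb`
    -- applies; if it leaves downwards, then induction on the number of the ladder does.
    descend : ∀ n j → toℕ j ≡ n → ∀ d → Hits (j , d)
    descend n j eq d = good-sound (choice j) (config j) true (λ d → Hits (j , d))
      (λ s → hits-slot (inj₂ (j , s)) refl) (within j) (climb (2 * i ℕ.∸ toℕ j) j (ℕ.m∸n+n≡m (ℕ.≤-pred (Fin.toℕ<n j))))
      (λ _ → below n eq) d
      (proj₁ (proj₂ (stops-exist (config j))) d)
      where
      step : ∀ e → Φ′ (j , downs e) ≡ (j ⊕ -[1+ 0 ] , pivotAt (config (j ⊕ -[1+ 0 ])) (opp₀ (downs e)))
      step 0F = Φ-pivot j (downs 0F)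
      step 1F = Φ-pivot j (downs 1F)
      below : ∀ n → toℕ j ≡ n → ∀ e → Hits (j , downs e)
      below zero    eq e = hits-slot (inj₁ (inj₂ e)) (cong (_, downs e) (Fin.toℕ-injective (sym eq)))
      below (suc n) eq e = hits-step (step e) (descend n (j ⊕ -[1+ 0 ]) (toℕ-⊕-1 j eq) _)

    slot : Fin (4 + m * 3) → Dart G
    slot f = fromCell (slot′ (Sum.map (splitAt 2) (remQuot {m} 3) (splitAt 4 f)))

    slot-onto : ∀ s → ∃ λ f → slot f ≡ fromCell (slot′ s)
    slot-onto s = join 4 (m * 3) (code s) , cong (fromCell ∘ slot′)
        (trans (cong decode (Fin.splitAt-join 4 (m * 3) (code s))) (decode-code s))
      where
      code : (Fin 2 ⊎ Fin 2) ⊎ (Fin m × Fin 3) → Fin 4 ⊎ Fin (m * 3)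
      code = Sum.map (join 2 2) (uncurry combine)
      decode : Fin 4 ⊎ Fin (m * 3) → (Fin 2 ⊎ Fin 2) ⊎ (Fin m × Fin 3)
      decode = Sum.map (splitAt 2) (remQuot {m} 3)
      decode-code : ∀ s → decode (code s) ≡ s
      decode-code (inj₁ s)       = cong inj₁ (Fin.splitAt-join 2 2 s)
      decode-code (inj₂ (j , s)) = cong inj₂ (Fin.remQuot-combine {m} {3} j s)

    faces-≤ : ∀ {F} → Orbits φ F → F ≤ 4 + m * 3
    faces-≤ O = hitting-≤ O slot λ d → let
        n , s , e = descend _ (proj₁ (cell d)) refl (proj₂ (cell d))
        f , e′    = slot-onto s in
      n , f , trans (sym (fromCell-cell _)) (trans (cong fromCell
        (trans (iterate-semiconj cell (λ d → cong (cell ∘ φ) (sym (fromCell-cell d))) d n) e)) (sym e′))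

  genus-≥ : ∀ {h} → EmbedsIn G h → i ≤ h
  genus-≥ (S , h′ , h′≤h , O) = ℕ.≤-trans
    (genus-bound i h′ (vertices-≤ S O.vertices) (orbits-≤ edgeOrbits O.edges) (faces-≤ S O.faces) O.euler) h′≤h
    where module O = OfGenus O

-- Connectivity of combinatorial maps

-- The steps generate an equivalence relation, as points on an orbit reach each
-- other.
module Connectivity {D : Set} {σ α : D → D} {k l : ℕ} (O : Orbits σ k) (P : Orbits α l) where

  Step : D → D → Set
  Step a b = b ≡ σ a ⊎ b ≡ α a

  private
    module O = Orbits O
    module P = Orbits P

  along-σ : ∀ {x y} → O.orbit x ≡ O.orbit y → Star Step x y
  along-σ {x} {y} e = let n , e′ = Equivalence.to (O.same x y) e in subst (Star Step x) e′ (go n x)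
    where
    go : ∀ n x → Star Step x (iterate σ x n)
    go zero    x = ε
    go (suc n) x = inj₁ refl ◅ go n (σ x)

  along-α : ∀ {x y} → P.orbit x ≡ P.orbit y → Star Step x y
  along-α {x} {y} e = let n , e′ = Equivalence.to (P.same x y) e in subst (Star Step x) e′ (go n x)
    where
    go : ∀ n x → Star Step x (iterate α x n)
    go zero    x = ε
    go (suc n) x = inj₂ refl ◅ go n (α x)

  step-sym : ∀ {x y} → Step x y → Star Step y x
  step-sym {x} (inj₁ refl) = along-σ (sym (Equivalence.from (O.same x (σ x)) (1 , refl)))
  step-sym {x} (inj₂ refl) = along-α (sym (Equivalence.from (P.same x (α x)) (1 , refl)))

  star-sym : ∀ {x y} → Star Step x y → Star Step y x
  star-sym ε        = ε
  star-sym (s ◅ ss) = star-sym ss ◅◅ step-sym s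

-- The map

top-or-rung : ∀ x → cubeFace (x , 1F) ≡ inj₁ 1F ⊎ cubeFace (target x 2F , 1F) ≡ inj₁ 1F
top-or-rung = from-yes (every? λ x → Sum.≡-dec Fin._≟_ Fin._≟_ (cubeFace (x , 1F)) (inj₁ 1F) ⊎-dec
  Sum.≡-dec Fin._≟_ Fin._≟_ (cubeFace (target x 2F , 1F)) (inj₁ 1F))

module Embedding (i : ℕ) where
  open Construction i
  open LowerBound i using (genus-≥)

  Face : Set
  Face = Fin (3 + m * 3)

  face : Dart G → Face
  face = Orbits.orbit faceOrbits

  -- The faces of length 8i + 4: the face between the ladders, t and b.
  big : Fin 3 → Face
  big c = c ↑ˡ (m * 3)

  -- The squares 0F, 1F, 2F of the ladder j from left to right.
  square : Fin m → Fin 3 → Face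
  square j q = 3 ↑ʳ combine j q

  -- The dart of the cube below a dart.
  local : Dart G → CubeDart
  local d = proj₂ (cell d)

  -- The face of the cube below the face of a dart.
  kind : Dart G → Fin 3 ⊎ Fin 3
  kind d = cubeFace (local d)

  face-big : ∀ d {c} → kind d ≡ inj₁ c → face d ≡ big c
  face-big d e = cong (Φ.Label.label′ φ-orbits (cell d)) e

  face-square : ∀ d {q} → kind d ≡ inj₂ q → face d ≡ square (proj₁ (cell d)) q
  face-square d e = trans (cong (Φ.Label.label′ φ-orbits (cell d)) e) (cong (λ j → square j _) (⊕-0 _))

  size : Fin 3 ⊎ Fin 3 → ℕ
  size (inj₁ _) = 8 * i + 4
  size (inj₂ _) = 4

  len : Face → ℕ
  len f = [ const (8 * i + 4) , const 4 ]′ (splitAt 3 f)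

  len-big : ∀ c → len (big c) ≡ 8 * i + 4
  len-big c = cong [ const (8 * i + 4) , const 4 ]′ (Fin.splitAt-↑ˡ 3 c (m * 3))

  len-face : ∀ d → len (face d) ≡ size (kind d)
  len-face d with kind d in e
  ... | inj₁ c = len-big c
  ... | inj₂ q = refl

  -- The number of times that a belt goes around the face of the cube below it.
  order : Fin 3 ⊎ Fin 3 → ℕ
  order (inj₁ _) = m
  order (inj₂ _) = 1

  size-order : ∀ t → size t ≡ order t * 4
  size-order (inj₁ _) = lemma i
    where
    lemma : ∀ i → 8 * i + 4 ≡ suc (2 * i) * 4
    lemma = solve-∀
  size-order (inj₂ _) = refl

  kind-iterate : ∀ d n → kind (iterate φ d n) ≡ kind d
  kind-iterate d n = trans (cong (cubeFace ∘ proj₂) (cell-iterate-φ d n)) (cubeFace-iterate n (local d))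

  volt-loop : ∀ b → Φ.volt b 4 ≡ net (cubeFace b)
  volt-loop = from-yes (every? λ b → Φ.volt b 4 ℤ.≟ net (cubeFace b))

  ⊕-order : ∀ t j → j ⊕ (+ order t ℤ.* net t) ≡ j
  ⊕-order (inj₁ c) j = ⊕-m* (net (inj₁ c)) j
  ⊕-order (inj₂ q) j = ⊕-0 j

  loop : ∀ a (c : Cell) → iterate Φ.lift c (a * 4) ≡
         (proj₁ c ⊕ (+ a ℤ.* net (cubeFace (proj₂ c))) , proj₂ c)
  loop a (j , b) = Φ.iterate-loop (φ₀-loop b) (volt-loop b) a j

  belt-closes : ∀ d → iterate φ d (size (kind d)) ≡ d
  belt-closes d = cell-injective (begin
    cell (iterate φ d (size t))              ≡⟨ iterate-semiconj cell cell-φ d (size t) ⟩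
    iterate Φ.lift (cell d) (size t)         ≡⟨ cong (iterate Φ.lift (cell d)) (size-order t) ⟩
    iterate Φ.lift (cell d) (order t * 4)    ≡⟨ loop (order t) (cell d) ⟩
    (proj₁ (cell d) ⊕ (+ order t ℤ.* net t) , local d)  ≡⟨ cong (_, local d) (⊕-order t (proj₁ (cell d))) ⟩
    cell d                                   ∎)
    where
    t = kind d

  -- After q = 4a + r steps, the walk has been a times around the face of the cube.
  normal-form : ∀ q j b → iterate Φ.lift (j , b) q ≡
    (j ⊕ Φ.volt b (q % 4) ⊕ (+ (q / 4) ℤ.* net (cubeFace b)) , iterate φ₀ b (q % 4))
  normal-form q j b = begin
    iterate Φ.lift (j , b) q                       ≡⟨ cong (iterate Φ.lift (j , b)) (m≡m%n+[m/n]*n q 4) ⟩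
    iterate Φ.lift (j , b) (q % 4 + q / 4 * 4)     ≡⟨ iterate-+ Φ.lift (j , b) (q % 4) (q / 4 * 4) ⟩
    iterate Φ.lift (iterate Φ.lift (j , b) (q % 4)) (q / 4 * 4)
      ≡⟨ cong (λ c → iterate Φ.lift c (q / 4 * 4)) (Φ.iterate-lift j b (q % 4)) ⟩
    iterate Φ.lift (j ⊕ Φ.volt b (q % 4) , iterate φ₀ b (q % 4)) (q / 4 * 4)
      ≡⟨ loop (q / 4) (j ⊕ Φ.volt b (q % 4) , iterate φ₀ b (q % 4)) ⟩
    (j ⊕ Φ.volt b (q % 4) ⊕ (+ (q / 4) ℤ.* net (cubeFace (iterate φ₀ b (q % 4)))) , iterate φ₀ b (q % 4))
      ≡⟨ cong (λ t → (j ⊕ Φ.volt b (q % 4) ⊕ (+ (q / 4) ℤ.* net t) , iterate φ₀ b (q % 4))) (cubeFace-iterate (q % 4) b) ⟩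
    (j ⊕ Φ.volt b (q % 4) ⊕ (+ (q / 4) ℤ.* net (cubeFace b)) , iterate φ₀ b (q % 4)) ∎

  net-injective : ∀ t j {a b} → a < order t → b < order t →
                  j ⊕ (+ a ℤ.* net t) ≡ j ⊕ (+ b ℤ.* net t) → a ≡ b
  net-injective (inj₁ c) j a<m b<m e = unit-injective (unit-net c) j a<m b<m e
  net-injective (inj₂ q) j (s≤s z≤n) (s≤s z≤n) e = refl

  φ-injective : ∀ d {p q} → p < size (kind d) → q < size (kind d) →
                cell (iterate φ d p) ≡ cell (iterate φ d q) → p ≡ q
  φ-injective d {p} {q} p< q< e = begin
    p                     ≡⟨ m≡m%n+[m/n]*n p 4 ⟩
    p % 4 + p / 4 * 4     ≡⟨ cong₂ (λ r a → r + a * 4) r≡ a≡ ⟩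
    q % 4 + q / 4 * 4     ≡⟨ m≡m%n+[m/n]*n q 4 ⟨
    q                     ∎
    where
    j = proj₁ (cell d)
    b = local d
    form : ∀ q → cell (iterate φ d q) ≡ (j ⊕ Φ.volt b (q % 4) ⊕ (+ (q / 4) ℤ.* net (kind d)) , iterate φ₀ b (q % 4))
    form q = trans (iterate-semiconj cell cell-φ d q) (normal-form q j b)
    e′ = trans (sym (form p)) (trans e (form q))
    r≡ : p % 4 ≡ q % 4
    r≡ = trans (sym (toℕ-mod p 4)) (trans (cong toℕ (φ₀-injective b (p mod 4) (q mod 4)
      (trans (cong (iterate φ₀ b) (toℕ-mod p 4))
        (trans (cong proj₂ e′) (cong (iterate φ₀ b) (sym (toℕ-mod q 4))))))) (toℕ-mod q 4))
    bound : ∀ {q} → q < size (kind d) → q / 4 < order (kind d)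
    bound {q} q< = m<n*o⇒m/o<n (subst (q <_) (size-order (kind d)) q<)
    a≡ : p / 4 ≡ q / 4
    a≡ = net-injective (kind d) (j ⊕ Φ.volt b (q % 4)) (bound p<) (bound q<)
      (trans (cong (λ r → j ⊕ Φ.volt b r ⊕ (+ (p / 4) ℤ.* net (kind d))) (sym r≡)) (cong proj₁ e′))

  -- A dart is determined by its source and any label that differs at the three darts.
  same-cell : {A : Set} (f : CubeDart → A) → (∀ x k k′ → f (x , k) ≡ f (x , k′) → k ≡ k′) →
              ∀ d d′ → src d ≡ src d′ → f (local d) ≡ f (local d′) → d ≡ d′
  same-cell f inj d d′ e e′ = cell-injective (lemma (cell d) (cell d′) (trans (sym (src-cell d)) (trans e (src-cell d′))) e′)
    where
    lemma : ∀ c c′ → vertexOf c ≡ vertexOf c′ → f (proj₂ c) ≡ f (proj₂ c′) → c ≡ c′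
    lemma (j , x , k) (j′ , x′ , k′) e e′ with vertex-injective e
    ... | refl = cong (λ k → j , x , k) (inj x k k′ e′)

  src-φ : ∀ d → src (φ d) ≡ tgt d
  src-φ d@(dart _ _ _) = Rotation.σ-src R (opp G d)

  adjacent : ∀ d → src d ~ src (φ d)
  adjacent d = subst (src d ~_) (sym (src-φ d)) (_ , proj₂ (direction d))

  iterate-suc : ∀ d n → iterate φ d (suc n) ≡ φ (iterate φ d n)
  iterate-suc d n = sym (iterate-semiconj φ (λ _ → refl) d n)

  belt : ∀ d → IsCycle G (len (face d)) (λ j → src (iterate φ d j))
  belt d = subst (λ L → IsCycle G L (λ j → src (iterate φ d j))) (sym (len-face d)) (record
    { 3≤k      = 3≤size (kind d)
    ; adjacent = λ q → subst (λ e → src (iterate φ d q) ~ src e) (sym (iterate-suc d q)) (adjacent (iterate φ d q))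
    ; periodic = λ q → cong src (trans (cong (iterate φ d) (ℕ.+-comm q L))
                   (trans (iterate-+ φ d L q) (cong (λ d → iterate φ d q) (belt-closes d))))
    ; distinct = λ {p} {q} p< q< e → φ-injective d p< q<
        (cong cell (same-cell cubeFace cubeFace-injective _ _ e (trans (kind-iterate d p) (sym (kind-iterate d q)))))
    })
    where
    L = size (kind d)
    3≤size : ∀ t → 3 ≤ size t
    3≤size (inj₁ _) = ℕ.≤-trans (s≤s (s≤s (s≤s z≤n))) (ℕ.m≤n+m 4 (8 * i))
    3≤size (inj₂ _) = s≤s (s≤s (s≤s z≤n))

  module Con = Connectivity vertexOrbits edgeOrbits

  same-vertex : ∀ {d d′} → src d ≡ src d′ → Star Con.Step d d′
  same-vertex e = Con.along-σ (cong (λ u → let j , x = coordinates u in 0 ↑ʳ combine (j ⊕ + 0) x) e)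

  along-φ : ∀ n d → Star Con.Step d (iterate φ d n)
  along-φ zero    d = ε
  along-φ (suc n) d = inj₂ refl ◅ inj₁ refl ◅ along-φ n (φ d)

  -- Every dart is connected to one on the face t, either at the same vertex or
  -- at the other end of the rung.
  to-top : ∀ c → ∃ λ e → kind e ≡ inj₁ 1F × Star Con.Step (fromCell c) e
  to-top (j , x , k) with top-or-rung x
  ... | inj₁ h = fromCell (j , x , 1F) , trans (cong (cubeFace ∘ proj₂) (cell-fromCell _)) h , same-vertex refl
  ... | inj₂ h = fromCell (j ⊕ + 0 , target x 2F , 1F) , trans (cong (cubeFace ∘ proj₂) (cell-fromCell _)) h ,
      same-vertex {_} {fromCell (j , x , 2F)} refl ◅◅
      inj₂ (sym (opp-fromCell (j , x , 2F))) ◅ same-vertex (cong (λ v → vertex (j ⊕ v) (target x 2F)) (rung x))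
    where
    rung : ∀ x → voltage (x , 2F) ≡ + 0
    rung = from-yes (every? λ x → voltage (x , 2F) ℤ.≟ + 0)

  connected : ∀ d d′ → Star Con.Step d d′
  connected d d′ with to-top (cell d) | to-top (cell d′)
  ... | e , he , p | e′ , he′ , p′ =
    subst (λ d → Star Con.Step d e) (fromCell-cell d) p ◅◅
    (let n , h = Equivalence.to (Orbits.same faceOrbits e e′) (trans (face-big e he) (sym (face-big e′ he′)))
     in subst (Star Con.Step e) h (along-φ n e)) ◅◅
    Con.star-sym (subst (λ d → Star Con.Step d e′) (fromCell-cell d′) p′)

  ofGenus : OfGenus σ (opp G) i
  ofGenus = record
    { #vertices = m * 8 ; #edges = m * 12 ; #faces = 3 + m * 3
    ; vertices = vertexOrbits ; edges = edgeOrbits ; faces = faceOrbits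
    ; connected = connected
    ; euler = lemma i }
    where
    lemma : ∀ i → suc (2 * i) * 8 + (3 + suc (2 * i) * 3) + 2 * i ≡ suc (2 * i) * 12 + 2
    lemma = solve-∀

  isGenus : IsGenus G i
  isGenus = (R , i , ℕ.≤-refl , ofGenus) , λ _ → genus-≥

  M : Map G
  M = record
    { rotation = R ; genus = i ; minimal = isGenus ; ofGenus = ofGenus
    ; #faces = 3 + m * 3 ; faceOrbits = faceOrbits ; len = len ; belt = belt }

  isConnected : IsConnected G
  isConnected u w = subst₂ (Star _~_) (src-at u) (src-at w) (walk (connected (at u) (at w)))
    where
    at : Fin (m * 8) → Dart G
    at u = fromCell (proj₁ (coordinates u) , proj₂ (coordinates u) , 0F)
    src-at : ∀ u → src (at u) ≡ u
    src-at = vertex-coordinates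
    walk : ∀ {d d′} → Star Con.Step d d′ → Star _~_ (src d) (src d′)
    walk ε = ε
    walk {d} (inj₁ refl ◅ p) = subst (λ u → Star _~_ u _) (Rotation.σ-src R d) (walk p)
    walk {d@(dart _ _ _)} (inj₂ refl ◅ p) = (_ , proj₂ (direction d)) ◅ walk p

  isCubic : IsCubic G
  isCubic u = nbr u , nbr-injective u , λ _ → mk⇔ id id

-- Colours on the cube

toPermutation : ∀ {n} (f : Fin n → Fin n) → (∀ x y → f x ≡ f y → x ≡ y) → (∀ y → ∃ λ x → f x ≡ y) → Permutation′ n
toPermutation f inj surj = permutation f (proj₁ ∘ surj) (proj₂ ∘ surj) (λ x → inj _ _ (proj₂ (surj (f x))))

iterate-φ₀-mod : ∀ d n → iterate φ₀ d n ≡ iterate φ₀ d (toℕ (n mod 4))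
iterate-φ₀-mod d n = begin
  iterate φ₀ d n                           ≡⟨ cong (iterate φ₀ d) (m≡m%n+[m/n]*n n 4) ⟩
  iterate φ₀ d (n % 4 + n / 4 * 4)         ≡⟨ iterate-+ φ₀ d (n % 4) (n / 4 * 4) ⟩
  iterate φ₀ (iterate φ₀ d (n % 4)) (n / 4 * 4)  ≡⟨ rounds (n / 4) _ ⟩
  iterate φ₀ d (n % 4)                     ≡⟨ cong (iterate φ₀ d) (toℕ-mod n 4) ⟨
  iterate φ₀ d (toℕ (n mod 4))             ∎
  where
  rounds : ∀ a d → iterate φ₀ d (a * 4) ≡ d
  rounds zero    d = refl
  rounds (suc a) d = trans (cong (λ d → iterate φ₀ d (a * 4)) (φ₀-loop d)) (rounds a d)

-- The ends of each rung have colours that differ by 2 modulo 4.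
vcol₀ : Fin 8 → Fin 4
vcol₀ = lookup (0F ∷ 1F ∷ 2F ∷ 3F ∷ 1F ∷ 0F ∷ 3F ∷ 2F ∷ [])

ecol₀ : CubeDart → Fin 4
ecol₀ d = lookup (2F ∷ 3F ∷ 0F ∷ 1F ∷ 3F ∷ 2F ∷ 1F ∷ 0F ∷ 3F ∷ 0F ∷ 1F ∷ 2F ∷ []) (cubeEdge d)

ecol₀-opp₀ : ∀ d → ecol₀ (opp₀ d) ≡ ecol₀ d
ecol₀-opp₀ = from-yes (every? λ d → ecol₀ (opp₀ d) Fin.≟ ecol₀ d)

vcol₀-proper : ∀ x k → vcol₀ (target x k) ≢ vcol₀ x
vcol₀-proper = from-yes (every? λ x → every? λ k → ¬? (vcol₀ (target x k) Fin.≟ vcol₀ x))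

vcol₀-injective : ∀ x k k′ → vcol₀ (target x k) ≡ vcol₀ (target x k′) → k ≡ k′
vcol₀-injective = from-yes (every? λ x → every? λ k → every? λ k′ →
  (vcol₀ (target x k) Fin.≟ vcol₀ (target x k′)) →-dec (k Fin.≟ k′))

vcol₀-surjective : ∀ x c → vcol₀ x ≡ c ⊎ ∃ λ k → vcol₀ (target x k) ≡ c
vcol₀-surjective = from-yes (every? λ x → every? λ c →
  (vcol₀ x Fin.≟ c) ⊎-dec Fin.any? λ k → vcol₀ (target x k) Fin.≟ c)

ecol₀-injective : ∀ x k k′ → ecol₀ (x , k) ≡ ecol₀ (x , k′) → k ≡ k′
ecol₀-injective = from-yes (every? λ x → every? λ k → every? λ k′ →
  (ecol₀ (x , k) Fin.≟ ecol₀ (x , k′)) →-dec (k Fin.≟ k′))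

ecol₀-vcol₀ : ∀ d → ecol₀ d ≢ vcol₀ (proj₁ d)
ecol₀-vcol₀ = from-yes (every? λ d → ¬? (ecol₀ d Fin.≟ vcol₀ (proj₁ d)))

-- The colours of the edges on the walk from x in the directions k₀ k₁ k₂ k₃.
edgeColours : Fin 8 → Fin 3 → Fin 3 → Fin 3 → Fin 3 → Vec (Fin 4) 4
edgeColours x k₀ k₁ k₂ k₃ =
  let x₁ = target x k₀; x₂ = target x₁ k₁; x₃ = target x₂ k₂ in
  ecol₀ (x , k₀) ∷ ecol₀ (x₁ , k₁) ∷ ecol₀ (x₂ , k₂) ∷ ecol₀ (x₃ , k₃) ∷ []

-- The closed walks of length 4 without backtracking in the cube go around its
-- faces, and the four edges of each face have different colours.
abstract
  edgeColours-injective : ∀ x k₀ k₁ k₂ k₃ → k₁ ≢ reverse k₀ → k₂ ≢ reverse k₁ → k₃ ≢ reverse k₂ →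
    x ≡ target (target (target (target x k₀) k₁) k₂) k₃ →
    ∀ a b → lookup (edgeColours x k₀ k₁ k₂ k₃) a ≡ lookup (edgeColours x k₀ k₁ k₂ k₃) b → a ≡ b
  edgeColours-injective = from-yes (every? λ x → every? λ k₀ → every? λ k₁ → every? λ k₂ → every? λ k₃ →
    ¬? (k₁ Fin.≟ reverse k₀) →-dec ¬? (k₂ Fin.≟ reverse k₁) →-dec ¬? (k₃ Fin.≟ reverse k₂) →-dec
    (x Fin.≟ target (target (target (target x k₀) k₁) k₂) k₃) →-dec
    every? λ a → every? λ b →
      (lookup (edgeColours x k₀ k₁ k₂ k₃) a Fin.≟ lookup (edgeColours x k₀ k₁ k₂ k₃) b) →-dec (a Fin.≟ b))

-- The colours of the four vertices of the face to the right of d, clockwise.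
around : CubeDart → Fin 4 → Fin 4
around d r = vcol₀ (proj₁ (iterate φ₀ d (toℕ r)))

around-injective : ∀ d r r′ → around d r ≡ around d r′ → r ≡ r′
around-injective = from-yes (every? λ d → every? λ (r : Fin 4) → every? λ (r′ : Fin 4) →
  (around d r Fin.≟ around d r′) →-dec (r Fin.≟ r′))

around-surjective : ∀ d c → ∃ λ r → around d r ≡ c
around-surjective = from-yes (every? λ d → every? λ c → Fin.any? λ (r : Fin 4) → around d r Fin.≟ c)

beltPermutation : CubeDart → Permutation′ 4
beltPermutation d = toPermutation (around d) (around-injective d) (around-surjective d)

-- In the word a b c a d c b d, the vertices are a c d b; so a b c d are the colours
-- of the vertices number 0, 3, 1, 2.
reorder : Fin 4 → Fin 4
reorder = lookup (0F ∷ 3F ∷ 1F ∷ 2F ∷ [])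

reorder⁻¹ : Fin 4 → Fin 4
reorder⁻¹ = lookup (0F ∷ 2F ∷ 3F ∷ 1F ∷ [])

reordering : Permutation′ 4
reordering = permutation reorder reorder⁻¹
  (from-yes (every? λ x → reorder (reorder⁻¹ x) Fin.≟ x)) (from-yes (every? λ x → reorder⁻¹ (reorder x) Fin.≟ x))

periodPermutation : CubeDart → Permutation′ 4
periodPermutation d = reordering ∘ₚ beltPermutation d

pattern-word : Vec (Fin 4) 8
pattern-word = 0F ∷ 1F ∷ 2F ∷ 0F ∷ 3F ∷ 2F ∷ 1F ∷ 3F ∷ []

word-vertices : ∀ d (r : Fin 4) →
  around d r ≡ around d (reorder (lookup pattern-word ((2 * toℕ r) mod 8)))
word-vertices = from-yes (every? λ d → every? λ (r : Fin 4) →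
  around d r Fin.≟ around d (reorder (lookup pattern-word ((2 * toℕ r) mod 8))))

word-edges : ∀ d (r : Fin 4) → ecol₀ (iterate φ₀ d (toℕ r)) ≡
  around d (reorder (lookup pattern-word ((1 + 2 * toℕ r) mod 8)))
word-edges = from-yes (every? λ d → every? λ (r : Fin 4) → ecol₀ (iterate φ₀ d (toℕ r)) Fin.≟
  around d (reorder (lookup pattern-word ((1 + 2 * toℕ r) mod 8))))

-- The permutations of the six faces of the cube, which are all different.  The
-- number k stands for the colour k + 1.
pfc₀ : Fin 3 ⊎ Fin 3 → Fin 3 → Fin 3
pfc₀ (inj₁ 0F) = lookup (1F ∷ 0F ∷ 2F ∷ [])
pfc₀ (inj₁ 1F) = lookup (2F ∷ 1F ∷ 0F ∷ [])
pfc₀ (inj₁ 2F) = lookup (0F ∷ 1F ∷ 2F ∷ [])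
pfc₀ (inj₂ 0F) = lookup (0F ∷ 2F ∷ 1F ∷ [])
pfc₀ (inj₂ 1F) = lookup (2F ∷ 0F ∷ 1F ∷ [])
pfc₀ (inj₂ 2F) = lookup (1F ∷ 2F ∷ 0F ∷ [])

pfcPermutation : Fin 3 ⊎ Fin 3 → Permutation′ 3
pfcPermutation t = toPermutation (pfc₀ t)
  (from-yes (every? λ t → every? λ x → every? λ y → (pfc₀ t x Fin.≟ pfc₀ t y) →-dec (x Fin.≟ y)) t)
  (from-yes (every? λ t → every? λ y → Fin.any? λ x → pfc₀ t x Fin.≟ y) t)

pfc₀-reads : ∀ d → vcol₀ (proj₁ d) ≡ 0F → ∀ k → vcol₀ (proj₁ (iterate φ₀ d (suc (toℕ k)))) ≡ suc (pfc₀ (cubeFace d) k)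
pfc₀-reads = from-yes (every? λ d → (vcol₀ (proj₁ d) Fin.≟ 0F) →-dec
  every? λ k → vcol₀ (proj₁ (iterate φ₀ d (suc (toℕ k)))) Fin.≟ suc (pfc₀ (cubeFace d) k))

pfc₀-adjacent : ∀ d → ∃ λ k → pfc₀ (cubeFace d) k ≢ pfc₀ (cubeFace (opp₀ d)) k
pfc₀-adjacent = from-yes (every? λ d → Fin.any? λ k → ¬? (pfc₀ (cubeFace d) k Fin.≟ pfc₀ (cubeFace (opp₀ d)) k))

-- Every vertex is on a square of its ladder.
on-square : ∀ x → ∃ λ k → ∃ λ q → cubeFace (x , k) ≡ inj₂ q
on-square = from-yes (every? λ x → Fin.any? λ k → Fin.any? λ q → Sum.≡-dec Fin._≟_ Fin._≟_ (cubeFace (x , k)) (inj₂ q))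

-- The cube is bipartite, and hence so is G.
parity : Fin 8 → Bool
parity = lookup (false ∷ true ∷ false ∷ true ∷ false ∷ true ∷ false ∷ true ∷ [])

parity-target : ∀ x k → parity (target x k) ≡ not (parity x)
parity-target = from-yes (every? λ x → every? λ k → parity (target x k) Bool.≟ not (parity x))

-- Colourings of the map

module Colouring (i : ℕ) where
  open Construction i
  open Embedding i

  -- The vertex of the cube below a vertex.
  corner : Fin (m * 8) → Fin 8
  corner u = proj₂ (coordinates u)

  corner-nbr : ∀ u k → corner (nbr u k) ≡ target (corner u) k
  corner-nbr u k = cong proj₂ (coordinates-vertex _ _)

  colouring : Coloring G
  colouring = record
    { vcol     = vcol₀ ∘ corner
    ; ecol     = ecol₀ ∘ local
    ; ecol-opp = λ d → trans (cong (ecol₀ ∘ proj₂) (cell-opp d)) (ecol₀-opp₀ (local d))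
    }

  open Coloring colouring

  vcol-nbr : ∀ u k → vcol (nbr u k) ≡ vcol₀ (target (corner u) k)
  vcol-nbr u k = cong vcol₀ (corner-nbr u k)

  vcol-proper : ∀ {u w} → u ~ w → vcol u ≢ vcol w
  vcol-proper {u} (k , refl) e = vcol₀-proper (corner u) k (trans (sym (vcol-nbr u k)) (sym e))

  isTotal : IsTotalColoring G colouring
  isTotal = record
    { vertex-vertex = vcol-proper
    ; edge-edge     = λ {d} {d′} e d≢d′ e′ → d≢d′ (same-cell ecol₀ ecol₀-injective d d′ e e′)
    ; edge-vertex   = λ d → ecol₀-vcol₀ (local d)
    }

  rainbow-injective : ∀ v {u w} → N[_] G v u → N[_] G v w → vcol u ≡ vcol w → u ≡ w
  rainbow-injective v (inj₁ refl) (inj₁ refl) e = refl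
  rainbow-injective v (inj₁ refl) (inj₂ a)    e = contradiction e (vcol-proper a)
  rainbow-injective v (inj₂ a)    (inj₁ refl) e = contradiction (sym e) (vcol-proper a)
  rainbow-injective v (inj₂ (k , refl)) (inj₂ (k′ , refl)) e =
    cong (nbr v) (vcol₀-injective (corner v) k k′ (trans (sym (vcol-nbr v k)) (trans e (vcol-nbr v k′))))

  rainbow-surjective : ∀ v c → ∃ λ u → N[_] G v u × vcol u ≡ c
  rainbow-surjective v c with vcol₀-surjective (corner v) c
  ... | inj₁ e       = v , inj₁ refl , e
  ... | inj₂ (k , e) = nbr v k , inj₂ (k , refl) , trans (vcol-nbr v k) e

  isEDS : ∀ c → IsEDS G (λ v → vcol v ≡ c)
  isEDS c v with rainbow-surjective v c
  ... | u , u∈N , e = const u , (λ { {0F} {0F} _ → refl }) ,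
    λ x → mk⇔ (λ (x∈N , e′) → 0F , rainbow-injective v u∈N x∈N (trans e (sym e′))) λ { (_ , refl) → u∈N , e }

  isETC : IsETC G colouring
  isETC = record { total = isTotal ; inj = rainbow-injective ; surj = rainbow-surjective ; eds = isEDS }

  -- An injective function on Fin 4 cannot omit a value.
  bijective : (f : Fin 4 → Fin 4) → (∀ a b → f a ≡ f b → a ≡ b) → Bijective {A = Fin 4} _≡_ _≡_ f
  bijective f inj = (λ {a} {b} → inj a b) , λ y → let x , e = surj y in x , λ { refl → e }
    where
    surj : ∀ y → ∃ λ x → f x ≡ y
    surj y with Fin.any? (λ x → f x Fin.≟ y)
    ... | yes p = p
    ... | no ¬p = contradiction
      (Fin.injective⇒≤ {f = λ x → Fin.punchOut {i = y} {f x} (λ e → ¬p (x , sym e))}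
        (λ {a} {b} e → inj a b (Fin.punchOut-injective {i = y} _ _ e))) (ℕ.<-irrefl refl)

  module FourCycle {c : ℕ → Fin (m * 8)} (C : IsCycle G 4 c) where
    open IsCycle C renaming (adjacent to adj)

    c₃~c₀ : c 3 ~ c 0
    c₃~c₀ = subst (c 3 ~_) (periodic 0) (adj 3)

    -- Any two vertices of a 4-cycle are in a common closed neighbourhood.
    near : ∀ (a b : Fin 4) → ∃ λ v → N[_] G v (c (toℕ a)) × N[_] G v (c (toℕ b))
    near 0F 3F = c 0 , inj₁ refl , inj₂ (~-sym c₃~c₀)
    near 3F 0F = c 0 , inj₂ (~-sym c₃~c₀) , inj₁ refl
    near 3F 3F = c 3 , inj₁ refl , inj₁ refl
    near 3F 1F = c 2 , inj₂ (adj 2) , inj₂ (~-sym (adj 1))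
    near 3F 2F = c 2 , inj₂ (adj 2) , inj₁ refl
    near 1F 3F = c 2 , inj₂ (~-sym (adj 1)) , inj₂ (adj 2)
    near 2F 3F = c 2 , inj₁ refl , inj₂ (adj 2)
    near 0F 0F = c 0 , inj₁ refl , inj₁ refl
    near 0F 1F = c 1 , inj₂ (~-sym (adj 0)) , inj₁ refl
    near 0F 2F = c 1 , inj₂ (~-sym (adj 0)) , inj₂ (adj 1)
    near 1F 0F = c 1 , inj₁ refl , inj₂ (~-sym (adj 0))
    near 1F 1F = c 1 , inj₁ refl , inj₁ refl
    near 1F 2F = c 1 , inj₁ refl , inj₂ (adj 1)
    near 2F 0F = c 1 , inj₂ (adj 1) , inj₂ (~-sym (adj 0))
    near 2F 1F = c 1 , inj₂ (adj 1) , inj₁ refl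
    near 2F 2F = c 2 , inj₁ refl , inj₁ refl

    vertices-injective : ∀ (a b : Fin 4) → vcol (c (toℕ a)) ≡ vcol (c (toℕ b)) → a ≡ b
    vertices-injective a b e = let v , p , q = near a b in
      Fin.toℕ-injective (distinct (Fin.toℕ<n a) (Fin.toℕ<n b) (rainbow-injective v p q e))

    side : ∀ j → Dart G
    side j = dart (c j) (c (suc j)) (adj j)

    -- The direction of the edge number j of the 4-cycle.
    dir : ℕ → Fin 3
    dir j = proj₁ (direction (side j))

    leads : ∀ j → nbr (c j) (dir j) ≡ c (suc j)
    leads j = proj₂ (direction (side j))

    corner-leads : ∀ j → corner (c (suc j)) ≡ target (corner (c j)) (dir j)
    corner-leads j = trans (cong corner (sym (leads j))) (corner-nbr (c j) (dir j))

    no-backtrack : ∀ j → c (2 + j) ≢ c j → dir (suc j) ≢ reverse (dir j)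
    no-backtrack j c≢ e = c≢ (begin
      c (2 + j)                                  ≡⟨ leads (suc j) ⟨
      nbr (c (suc j)) (dir (suc j))              ≡⟨ cong₂ nbr (sym (leads j)) e ⟩
      nbr (nbr (c j) (dir j)) (reverse (dir j))  ≡⟨ nbr-reverse (c j) (dir j) ⟩
      c j                                        ∎)

    edges : ∀ {x₀ x₁ x₂ x₃} k₀ k₁ k₂ k₃ → x₁ ≡ target x₀ k₀ → x₂ ≡ target x₁ k₁ → x₃ ≡ target x₂ k₂ → x₀ ≡ target x₃ k₃ →
            k₁ ≢ reverse k₀ → k₂ ≢ reverse k₁ → k₃ ≢ reverse k₂ →
            ∀ a b → lookup (ecol₀ (x₀ , k₀) ∷ ecol₀ (x₁ , k₁) ∷ ecol₀ (x₂ , k₂) ∷ ecol₀ (x₃ , k₃) ∷ []) a ≡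
                    lookup (ecol₀ (x₀ , k₀) ∷ ecol₀ (x₁ , k₁) ∷ ecol₀ (x₂ , k₂) ∷ ecol₀ (x₃ , k₃) ∷ []) b → a ≡ b
    edges k₀ k₁ k₂ k₃ refl refl refl e n₁ n₂ n₃ = edgeColours-injective _ k₀ k₁ k₂ k₃ n₁ n₂ n₃ e

    edgeList : Vec (Fin 4) 4
    edgeList = ecol (side 0) ∷ ecol (side 1) ∷ ecol (side 2) ∷ ecol (side 3) ∷ []

    edge-lookup : ∀ (a : Fin 4) → ecol (side (toℕ a)) ≡ lookup edgeList a
    edge-lookup 0F = refl
    edge-lookup 1F = refl
    edge-lookup 2F = refl
    edge-lookup 3F = refl

    apart : ∀ {a b} → a < 4 → b < 4 → a ≢ b → c a ≢ c b
    apart a< b< a≢b e = a≢b (distinct a< b< e)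

    edges-injective : ∀ (a b : Fin 4) → ecol (side (toℕ a)) ≡ ecol (side (toℕ b)) → a ≡ b
    edges-injective a b e = edges (dir 0) (dir 1) (dir 2) (dir 3)
      (corner-leads 0) (corner-leads 1) (corner-leads 2)
      (trans (cong corner (sym (periodic 0))) (corner-leads 3))
      (no-backtrack 0 (apart (s≤s (s≤s (s≤s z≤n))) (s≤s z≤n) λ ()))
      (no-backtrack 1 (apart (s≤s (s≤s (s≤s (s≤s z≤n)))) (s≤s (s≤s z≤n)) λ ()))
      (no-backtrack 2 λ e → apart (s≤s z≤n) (s≤s (s≤s (s≤s z≤n))) (λ ()) (trans (sym (periodic 0)) e))
      a b (trans (sym (edge-lookup a)) (trans e (edge-lookup b)))

  isETGC : IsETGC G colouring
  isETGC = record
    { etc        = isETC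
    ; 4-vertices = λ C → bijective _ (FourCycle.vertices-injective C)
    ; 4-edges    = λ C → bijective _ (FourCycle.edges-injective C)
    }

  local-iterate : ∀ d n → local (iterate φ d n) ≡ iterate φ₀ (local d) n
  local-iterate d n = cong proj₂ (cell-iterate-φ d n)

  vcol-iterate : ∀ d n → vcol (src (iterate φ d n)) ≡ around (local d) (n mod 4)
  vcol-iterate d n = trans (cong (vcol₀ ∘ proj₁) (local-iterate d n))
    (cong (vcol₀ ∘ proj₁) (iterate-φ₀-mod (local d) n))

  ecol-iterate : ∀ d n → ecol (iterate φ d n) ≡ ecol₀ (iterate φ₀ (local d) (toℕ (n mod 4)))
  ecol-iterate d n = trans (cong ecol₀ (local-iterate d n)) (cong ecol₀ (iterate-φ₀-mod (local d) n))

  4∣len : ∀ d → 4 ∣ len (face d)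
  4∣len d = divides (order (kind d)) (trans (len-face d) (size-order (kind d)))

  4∣len-any : ∀ f → 4 ∣ len f
  4∣len-any f = let d , e = Orbits.onto faceOrbits f in subst (λ f → 4 ∣ len f) e (4∣len d)

  mod-word : ∀ c n → (c + 2 * n) mod 8 ≡ (c + 2 * toℕ (n mod 4)) mod 8
  mod-word c n = mod-cong (c + 2 * n) (c + 2 * toℕ (n mod 4)) 8 (begin
    (c + 2 * n) % 8                          ≡⟨ cong (λ n → (c + 2 * n) % 8) (m≡m%n+[m/n]*n n 4) ⟩
    (c + 2 * (n % 4 + n / 4 * 4)) % 8        ≡⟨ cong (_% 8) (lemma c (n % 4) (n / 4)) ⟩
    (c + 2 * (n % 4) + n / 4 * 8) % 8        ≡⟨ [m+kn]%n≡m%n (c + 2 * (n % 4)) (n / 4) 8 ⟩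
    (c + 2 * (n % 4)) % 8                    ≡⟨ cong (λ r → (c + 2 * r) % 8) (toℕ-mod n 4) ⟨
    (c + 2 * toℕ (n mod 4)) % 8              ∎)
    where
    lemma : ∀ c r a → c + 2 * (r + a * 4) ≡ c + 2 * r + a * 8
    lemma = solve-∀

  isPeriodic : IsPeriodic M colouring
  isPeriodic f = let d , e = Orbits.onto faceOrbits f; b = local d in
    4∣len-any f , iterate φ d , clockwise e (iterate-suc d) , periodPermutation b , λ n →
      trans (vcol-iterate d n) (trans (word-vertices b (n mod 4))
        (cong (around b ∘ reorder ∘ lookup pattern-word) (sym (mod-word 0 n)))) ,
      trans (ecol-iterate d n) (trans (word-edges b (n mod 4))
        (cong (around b ∘ reorder ∘ lookup pattern-word) (sym (mod-word 1 n))))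

  four-cycle : ∀ u → ∃ λ c → IsCycle G 4 c × c 0 ≡ u
  four-cycle u = _ , subst (λ L → IsCycle G L (λ j → src (iterate φ d j))) 4-long (belt d) , vertex-coordinates u
    where
    x = corner u
    k = proj₁ (on-square x)
    d = fromCell (proj₁ (coordinates u) , x , k)
    4-long : len (face d) ≡ 4
    4-long = trans (len-face d) (cong size
      (trans (cong (cubeFace ∘ proj₂) (cell-fromCell (proj₁ (coordinates u) , x , k))) (proj₂ (proj₂ (on-square x)))))

  noYVertex : ∀ u → ¬ YVertex G u
  noYVertex u y = let _ , C , e = four-cycle u in y C 0 e

  isYMap : IsYMap M
  isYMap f with 4∣len-any f
  ... | divides q e = q * 2 , trans e (lemma q) , λ d _ (y , _) → ⊥-elim (noYVertex (src d) y)
    where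
    lemma : ∀ q → q * 4 ≡ 2 * (q * 2)
    lemma = solve-∀

  isΠMap : IsΠMap M
  isΠMap = isYMap , vcol , isEDS , λ d → 4∣len d , beltPermutation (local d) , vcol-iterate d

  pfc : Face → Permutation′ 3
  pfc f = pfcPermutation (Sum.map id (proj₂ ∘ remQuot {m} 3) (splitAt 3 f))

  pfc-face : ∀ d k → pfc (face d) ⟨$⟩ʳ k ≡ pfc₀ (kind d) k
  pfc-face d k = cong (λ t → pfc₀ t k) (kind-face d)
    where
    kind-face : ∀ d → Sum.map id (proj₂ ∘ remQuot {m} 3) (splitAt 3 (face d)) ≡ kind d
    kind-face d with kind d in e
    ... | inj₁ c = cong (Sum.map id (proj₂ ∘ remQuot {m} 3)) (Fin.splitAt-↑ˡ 3 c (m * 3))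
    ... | inj₂ q = cong inj₂ (cong proj₂ (Fin.remQuot-combine {m} {3} (proj₁ (cell d) ⊕ + 0) q))

  isAssociated : IsAssociatedPFC M colouring pfc
  isAssociated = reads , λ { f g (_ , d , refl , refl) same → distinct d same }
    where
    reads : ∀ d → vcol (src d) ≡ 0F → ∀ k →
            vcol (src (iterate φ d (suc (toℕ k)))) ≡ suc (pfc (face d) ⟨$⟩ʳ k)
    reads d e k = trans (cong (vcol₀ ∘ proj₁) (local-iterate d (suc (toℕ k))))
      (trans (pfc₀-reads (local d) e k) (cong suc (sym (pfc-face d k))))
    distinct : ∀ d → ¬ (pfc (face d) ≈ pfc (face (opp G d)))
    distinct d same = let k , k≢ = pfc₀-adjacent (local d) in k≢ (begin
      pfc₀ (kind d) k                     ≡⟨ pfc-face d k ⟨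
      pfc (face d) ⟨$⟩ʳ k                 ≡⟨ same k ⟩
      pfc (face (opp G d)) ⟨$⟩ʳ k         ≡⟨ pfc-face (opp G d) k ⟩
      pfc₀ (kind (opp G d)) k             ≡⟨ cong (λ c → pfc₀ (cubeFace (proj₂ c)) k) (cell-opp d) ⟩
      pfc₀ (cubeFace (opp₀ (local d))) k  ∎)

  hasGirth : HasGirth G 4
  hasGirth = (let c , C , _ = four-cycle (vertex zero 0F) in c , C) , minimal
    where
    alternates : ∀ {u w} → u ~ w → parity (corner w) ≡ not (parity (corner u))
    alternates {u} (k , refl) = trans (cong parity (corner-nbr u k)) (parity-target (corner u) k)
    odd : ∀ b → b ≢ not (not (not b))
    odd false ()
    odd true  ()
    minimal : ∀ {k c} → IsCycle G k c → 4 ≤ k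
    minimal {k} {c} C = ℕ.≤∧≢⇒< 3≤k λ { refl → odd (parity (corner (c 0))) (begin
      parity (corner (c 0))                    ≡⟨ cong (parity ∘ corner) (periodic 0) ⟨
      parity (corner (c 3))                    ≡⟨ alternates (adj 2) ⟩
      not (parity (corner (c 2)))              ≡⟨ cong not (alternates (adj 1)) ⟩
      not (not (parity (corner (c 1))))        ≡⟨ cong (not ∘ not) (alternates (adj 0)) ⟩
      not (not (not (parity (corner (c 0)))))  ∎) }
      where
      open IsCycle C renaming (adjacent to adj)

-- Cutting the ladders

flip₂ : Fin 2 → Fin 2
flip₂ 0F = 1F
flip₂ 1F = 0F

flip₂-involutive : ∀ b → flip₂ (flip₂ b) ≡ b
flip₂-involutive 0F = refl
flip₂-involutive 1F = refl

-- The parity of a number.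
par : ℕ → Fin 2
par zero    = 0F
par (suc n) = flip₂ (par n)

par-double : ∀ n → par (2 * n) ≡ 0F
par-double zero    = refl
par-double (suc n) = trans (cong (λ z → par (suc z)) (ℕ.+-suc n (n + 0))) (trans (flip₂-involutive _) (par-double n))

-- The points of a ladder are numbered by the half ladder (0F is the right half) and
-- the position on the side.
corner-number : Fin 2 → Fin 2 → Fin 4
corner-number = combine

-- The two points on the same edge are identified.
mirror : Fin 4 → Fin 4
mirror 0F = 3F
mirror 1F = 2F
mirror 2F = 1F
mirror 3F = 0F

arc₀-involutive : ∀ e → arc₀ (arc₀ e) ≡ e
arc₀-involutive = from-yes (every? λ e → arc₀ (arc₀ e) ≟ᵉ e)

arcVoltage-arc₀ : ∀ e → arcVoltage e ℤ.+ arcVoltage (arc₀ e) ≡ + 0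
arcVoltage-arc₀ = from-yes (every? λ e → arcVoltage e ℤ.+ arcVoltage (arc₀ e) ℤ.≟ + 0)

arc₀-no-fix : ∀ e → arc₀ e ≢ e
arc₀-no-fix = from-yes (every? λ e → ¬? (arc₀ e ≟ᵉ e))

-- An arc is an edge or the first part of a cut edge.
arc₀-opp₀ : ∀ d → arc₀ (inj₁ d) ≡ inj₁ (opp₀ d) ⊎
                  ∃ λ r → arc₀ (inj₁ d) ≡ inj₂ r × arc₀ (inj₂ (mirror r)) ≡ inj₁ (opp₀ d)
arc₀-opp₀ = from-yes (every? λ d → (arc₀ (inj₁ d) ≟ᵉ inj₁ (opp₀ d)) ⊎-dec
  Fin.any? λ r → (arc₀ (inj₁ d) ≟ᵉ inj₂ r) ×-dec (arc₀ (inj₂ (mirror r)) ≟ᵉ inj₁ (opp₀ d)))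

-- The dart at the other end of the arc from a point.
cutDart : Fin 4 → CubeDart
cutDart = lookup ((5F , 0F) ∷ (2F , 1F) ∷ (1F , 0F) ∷ (6F , 1F) ∷ [])

arc₀-cutDart : ∀ r → arc₀ (inj₂ r) ≡ inj₁ (cutDart r)
arc₀-cutDart = from-yes (every? λ r → arc₀ (inj₂ r) ≟ᵉ inj₁ (cutDart r))

-- The vertex x is incident with a cut edge.
Near : Fin 8 → Set
Near x = ∃ λ k → ∃ λ r → arc₀ (inj₁ (x , k)) ≡ inj₂ r

near-points : ∀ x → Near x ⊎ ∃ λ k → arc₀ (inj₁ (x , k)) ≡ inj₁ (opp₀ (x , k)) × Near (target x k)
near-points = from-yes (every? λ x → near? x ⊎-dec
  Fin.any? λ k → (arc₀ (inj₁ (x , k)) ≟ᵉ inj₁ (opp₀ (x , k))) ×-dec near? (target x k))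
  where
  near? : ∀ x → Dec (Near x)
  near? x = Fin.any? λ k → Fin.any? λ r → arc₀ (inj₁ (x , k)) ≟ᵉ inj₂ r

-- The cutout

module Cutting (i : ℕ) where
  open Construction i
  open Embedding i hiding (loop)

  -- Two points on each of the 2m sides.
  N : ℕ
  N = (m + m) * 2

  -- The side inj₁ j is number j and the side inj₂ j is number m + j.  Both belong to the
  -- ladder j.
  pt : Fin m ⊎ Fin m → Fin 2 → Fin N
  pt h b = combine (join m m h) b

  unpt : Fin N → (Fin m ⊎ Fin m) × Fin 2
  unpt p = let s , b = remQuot {m + m} 2 p in splitAt m s , b

  unpt-pt : ∀ h b → unpt (pt h b) ≡ (h , b)
  unpt-pt h b = trans (cong (λ (s , b) → splitAt m s , b) (Fin.remQuot-combine {m + m} {2} (join m m h) b))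
    (cong (_, b) (Fin.splitAt-join m m h))

  pt-unpt : ∀ p → uncurry pt (unpt p) ≡ p
  pt-unpt p = trans (cong (λ s → combine s (proj₂ (remQuot {m + m} 2 p))) (Fin.join-splitAt m m (proj₁ (remQuot {m + m} 2 p))))
    (Fin.combine-remQuot {m + m} 2 p)

  -- The number of a side.
  position : Fin m ⊎ Fin m → ℕ
  position (inj₁ j) = toℕ j
  position (inj₂ j) = m + toℕ j

  toℕ-pt : ∀ h b → toℕ (pt h b) ≡ 2 * position h + toℕ b
  toℕ-pt h b = trans (Fin.toℕ-combine (join m m h) b) (cong (λ z → 2 * z + toℕ b) (toℕ-join h))
    where
    toℕ-join : ∀ h → toℕ (join m m h) ≡ position h
    toℕ-join (inj₁ j) = Fin.toℕ-↑ˡ j m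
    toℕ-join (inj₂ j) = Fin.toℕ-↑ʳ m j

  ladder : Fin m ⊎ Fin m → Fin m
  ladder = [ id , id ]′

  -- The half ladder at a side.  Right and left halves alternate, and sides of even
  -- number are at right halves; as m is odd, opposite sides are at different halves of
  -- the same ladder.
  end : Fin m ⊎ Fin m → Fin 2
  end (inj₁ j) = par (toℕ j)
  end (inj₂ j) = flip₂ (par (toℕ j))

  -- The side of the ladder j for a given half ladder and the parity of j.
  half : Fin 2 → Fin 2 → Fin m → Fin m ⊎ Fin m
  half 0F 0F = inj₁
  half 1F 1F = inj₁
  half 0F 1F = inj₂
  half 1F 0F = inj₂

  sideAt : Fin m → Fin 2 → Fin m ⊎ Fin m
  sideAt j l = half l (par (toℕ j)) j

  ladder-sideAt : ∀ j l → ladder (sideAt j l) ≡ j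
  ladder-sideAt j l = lemma l (par (toℕ j))
    where
    lemma : ∀ l b → ladder (half l b j) ≡ j
    lemma 0F 0F = refl
    lemma 0F 1F = refl
    lemma 1F 0F = refl
    lemma 1F 1F = refl

  end-sideAt : ∀ j l → end (sideAt j l) ≡ l
  end-sideAt j l = lemma l (par (toℕ j)) refl
    where
    lemma : ∀ l b → par (toℕ j) ≡ b → end (half l b j) ≡ l
    lemma 0F 0F e = e
    lemma 0F 1F e = cong flip₂ e
    lemma 1F 0F e = cong flip₂ e
    lemma 1F 1F e = e

  sideAt-end : ∀ h → sideAt (ladder h) (end h) ≡ h
  sideAt-end (inj₁ j) = lemma (par (toℕ j))
    where
    lemma : ∀ b → half b b j ≡ inj₁ j
    lemma 0F = refl
    lemma 1F = refl
  sideAt-end (inj₂ j) = lemma (par (toℕ j))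
    where
    lemma : ∀ b → half (flip₂ b) b j ≡ inj₂ j
    lemma 0F = refl
    lemma 1F = refl

  -- The points in coordinates: the ladder and the number of the point in it.
  Point : Set
  Point = Fin m × Fin 4

  code : (Fin m ⊎ Fin m) × Fin 2 → Point
  code (h , b) = ladder h , corner-number (end h) b

  uncode : Point → (Fin m ⊎ Fin m) × Fin 2
  uncode (j , r) = let l , b = remQuot {2} 2 r in sideAt j l , b

  code-uncode : ∀ c → code (uncode c) ≡ c
  code-uncode (j , r) = let l , b = remQuot {2} 2 r in
    cong₂ _,_ (ladder-sideAt j l) (trans (cong (λ l → corner-number l b) (end-sideAt j l)) (Fin.combine-remQuot {2} 2 r))

  uncode-code : ∀ c → uncode (code c) ≡ c
  uncode-code (h , b) = trans (cong (λ (l , b) → sideAt (ladder h) l , b) (Fin.remQuot-combine {2} {2} (end h) b))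
    (cong (_, b) (sideAt-end h))

  toPoint : Fin N → Point
  toPoint p = code (unpt p)

  fromPoint : Point → Fin N
  fromPoint c = uncurry pt (uncode c)

  from-toPoint : ∀ p → fromPoint (toPoint p) ≡ p
  from-toPoint p = trans (cong (uncurry pt) (uncode-code (unpt p))) (pt-unpt p)

  to-fromPoint : ∀ c → toPoint (fromPoint c) ≡ c
  to-fromPoint c = trans (cong code (unpt-pt (proj₁ (uncode c)) (proj₂ (uncode c)))) (code-uncode c)

  toPoint-pt : ∀ h b → toPoint (pt h b) ≡ code (h , b)
  toPoint-pt h b = cong code (unpt-pt h b)

  toℕ-rotate : ∀ (p : Fin N) → toℕ (rotate p) ≡ suc (toℕ p) % N
  toℕ-rotate p = toℕ-mod (suc (toℕ p)) N

  rotate-to : ∀ (p q : Fin N) → suc (toℕ p) ≡ toℕ q → rotate p ≡ q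
  rotate-to p q e = Fin.toℕ-injective (trans (toℕ-rotate p)
    (trans (cong (_% N) e) (m<n⇒m%n≡m (Fin.toℕ<n q))))

  rotate-first : ∀ h → rotate (pt h 0F) ≡ pt h 1F
  rotate-first h = rotate-to (pt h 0F) (pt h 1F) (trans (cong suc (toℕ-pt h 0F)) (trans (lemma (position h)) (sym (toℕ-pt h 1F))))
    where
    lemma : ∀ n → suc (2 * n + 0) ≡ 2 * n + 1
    lemma = solve-∀

  -- From the second point on a side to the first point on the next side.
  rotate-second : ∀ h → ∃ λ h′ → rotate (pt h 1F) ≡ pt h′ 0F × ladder h′ ≡ ladder h ⊕ + 1 × end h′ ≡ flip₂ (end h)
  rotate-second h with ℕ.m≤n⇒m<n∨m≡n (ℕ.≤-pred (Fin.toℕ<n (ladder h)))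
  ... | inj₁ j<k = next h j<k
    where
    lemma : ∀ n → suc (2 * n + 1) ≡ 2 * suc n + 0
    lemma = solve-∀
    step : ∀ h h′ → position h′ ≡ suc (position h) → rotate (pt h 1F) ≡ pt h′ 0F
    step h h′ e = rotate-to (pt h 1F) (pt h′ 0F)
      (trans (cong suc (toℕ-pt h 1F)) (trans (lemma (position h)) (trans (cong (λ z → 2 * z + 0) (sym e)) (sym (toℕ-pt h′ 0F)))))
    next : ∀ h → toℕ (ladder h) < 2 * i →
           ∃ λ h′ → rotate (pt h 1F) ≡ pt h′ 0F × ladder h′ ≡ ladder h ⊕ + 1 × end h′ ≡ flip₂ (end h)
    next (inj₁ j) j<k = inj₁ (j ⊕ + 1) , step (inj₁ j) (inj₁ (j ⊕ + 1)) (toℕ-⊕1 j j<k) , refl , cong par (toℕ-⊕1 j j<k)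
    next (inj₂ j) j<k = inj₂ (j ⊕ + 1) ,
      step (inj₂ j) (inj₂ (j ⊕ + 1)) (trans (cong (λ z → m + z) (toℕ-⊕1 j j<k)) (ℕ.+-suc m (toℕ j))) , refl ,
      cong (flip₂ ∘ par) (toℕ-⊕1 j j<k)
  ... | inj₂ j≡k = wrap h j≡k
    where
    lemma : ∀ k → suc (2 * k + 1) ≡ 2 * (suc k + 0) + 0
    lemma = solve-∀
    lemma′ : ∀ k → suc (2 * (suc k + k) + 1) ≡ (suc k + suc k) * 2
    lemma′ = solve-∀
    zero≡ : ∀ j → toℕ j ≡ 2 * i → zero ≡ j ⊕ + 1
    zero≡ j e = Fin.toℕ-injective (sym (trans (⊕-toℕ j 1) (trans (cong (λ z → (z + 1) % m) e)
      (trans (cong (_% m) (ℕ.+-comm (2 * i) 1)) (n%n≡0 m)))))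
    even : ∀ j → toℕ j ≡ 2 * i → par (toℕ j) ≡ 0F
    even j e = trans (cong par e) (par-double i)
    wrap : ∀ h → toℕ (ladder h) ≡ 2 * i →
           ∃ λ h′ → rotate (pt h 1F) ≡ pt h′ 0F × ladder h′ ≡ ladder h ⊕ + 1 × end h′ ≡ flip₂ (end h)
    wrap (inj₁ j) e = inj₂ zero , rotate-to (pt (inj₁ j) 1F) (pt (inj₂ zero) 0F)
      (trans (cong suc (toℕ-pt (inj₁ j) 1F)) (trans (cong (λ z → suc (2 * z + 1)) e) (trans (lemma (2 * i)) (sym (toℕ-pt (inj₂ zero) 0F))))) ,
      zero≡ j e , sym (cong flip₂ (even j e))
    wrap (inj₂ j) e = inj₁ zero , Fin.toℕ-injective (trans (toℕ-rotate (pt (inj₂ j) 1F)) (trans (cong (_% N)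
      (trans (cong suc (toℕ-pt (inj₂ j) 1F)) (trans (cong (λ z → suc (2 * (m + z) + 1)) e) (lemma′ (2 * i)))))
      (trans (n%n≡0 N) (sym (toℕ-pt (inj₁ zero) 0F))))) ,
      zero≡ j e , sym (trans (flip₂-involutive (par (toℕ j))) (even j e))

  -- The next point along the polygon.
  spinPoint : Point → Point
  spinPoint (j , 0F) = j ⊕ + 0 , 1F
  spinPoint (j , 1F) = j ⊕ + 1 , 2F
  spinPoint (j , 2F) = j ⊕ + 0 , 3F
  spinPoint (j , 3F) = j ⊕ + 1 , 0F

  toPoint-rotate : ∀ p → toPoint (rotate p) ≡ spinPoint (toPoint p)
  toPoint-rotate p = subst (λ p → toPoint (rotate p) ≡ spinPoint (toPoint p)) (pt-unpt p)
      (trans (go (proj₁ (unpt p)) (proj₂ (unpt p))) (cong spinPoint (sym (toPoint-pt (proj₁ (unpt p)) (proj₂ (unpt p))))))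
    where
    first : ∀ j l → (j , corner-number l 1F) ≡ spinPoint (j , corner-number l 0F)
    first j 0F = cong (_, 1F) (sym (⊕-0 j))
    first j 1F = cong (_, 3F) (sym (⊕-0 j))
    second : ∀ j l → (j ⊕ + 1 , corner-number (flip₂ l) 0F) ≡ spinPoint (j , corner-number l 1F)
    second j 0F = refl
    second j 1F = refl
    go : ∀ h b → toPoint (rotate (pt h b)) ≡ spinPoint (code (h , b))
    go h 0F = trans (cong toPoint (rotate-first h)) (trans (toPoint-pt h 1F) (first (ladder h) (end h)))
    go h 1F = let h′ , e , e₁ , e₂ = rotate-second h in
      trans (cong toPoint e) (trans (toPoint-pt h′ 0F) (trans (cong₂ (λ j l → j , corner-number l 0F) e₁ e₂)
        (second (ladder h) (end h))))

  glue : Fin N → Fin N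
  glue p = let h , b = unpt p in pt (Sum.swap h) (flip₂ b)

  unpt-glue : ∀ p → unpt (glue p) ≡ (Sum.swap (proj₁ (unpt p)) , flip₂ (proj₂ (unpt p)))
  unpt-glue p = unpt-pt _ _

  toPoint-glue : ∀ p → toPoint (glue p) ≡ (proj₁ (toPoint p) , mirror (proj₂ (toPoint p)))
  toPoint-glue p = trans (cong code (unpt-glue p)) (lemma (proj₁ (unpt p)) (proj₂ (unpt p)))
    where
    mirror-corner : ∀ l b → corner-number (flip₂ l) (flip₂ b) ≡ mirror (corner-number l b)
    mirror-corner 0F 0F = refl
    mirror-corner 0F 1F = refl
    mirror-corner 1F 0F = refl
    mirror-corner 1F 1F = refl
    lemma : ∀ h b → code (Sum.swap h , flip₂ b) ≡ (ladder h , mirror (corner-number (end h) b))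
    lemma (inj₁ j) b = cong (j ,_) (mirror-corner (par (toℕ j)) b)
    lemma (inj₂ j) b = cong (j ,_) (trans (cong (λ l → corner-number l (flip₂ b)) (sym (flip₂-involutive (par (toℕ j)))))
      (mirror-corner (flip₂ (par (toℕ j))) b))

  boundary : Boundary m
  boundary = record
    { N               = N
    ; side            = side
    ; side-≤          = λ {p} {q} p≤q → ℕ.≮⇒≥ λ q<p → ℕ.<⇒≱
        (subst₂ Fin._<_ (Fin.combine-remQuot {m + m} 2 q) (Fin.combine-remQuot {m + m} 2 p)
          (Fin.combine-monoˡ-< _ _ q<p)) p≤q
    ; glue            = glue
    ; glue-involutive = λ p → trans (cong (λ (h , b) → pt (Sum.swap h) (flip₂ b)) (unpt-glue p))
        (trans (cong₂ pt (Sum.swap-involutive (proj₁ (unpt p))) (flip₂-involutive (proj₂ (unpt p)))) (pt-unpt p))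
    ; glue-side       = λ p → cong proj₁ (Fin.remQuot-combine {m + m} {2} (join m m (Sum.swap (proj₁ (unpt p)))) (flip₂ (proj₂ (unpt p))))
    ; glue-reverses   = λ {p} {q} e p<q → reverses (proj₁ (unpt p)) (proj₁ (unpt q)) (proj₂ (unpt p)) (proj₂ (unpt q))
        (cong (splitAt m) e) (subst₂ Fin._<_ (sym (pt-unpt p)) (sym (pt-unpt q)) p<q)
    }
    where
    side : Fin N → Fin (m + m)
    side p = proj₁ (remQuot {m + m} 2 p)
    reverses : ∀ h h′ b b′ → h ≡ h′ → pt h b Fin.< pt h′ b′ → pt (Sum.swap h′) (flip₂ b′) Fin.< pt (Sum.swap h) (flip₂ b)
    reverses h h 0F 0F refl lt = contradiction lt (ℕ.<-irrefl refl)
    reverses h h 1F 1F refl lt = contradiction lt (ℕ.<-irrefl refl)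
    reverses h h 0F 1F refl lt = subst₂ _<_ (sym (toℕ-pt (Sum.swap h) 0F)) (sym (toℕ-pt (Sum.swap h) 1F))
      (ℕ.+-monoʳ-< (2 * position (Sum.swap h)) (s≤s z≤n))
    reverses h h 1F 0F refl lt = contradiction (ℕ.+-cancelˡ-< (2 * position h) 1 0 (subst₂ _<_ (toℕ-pt h 1F) (toℕ-pt h 0F) lt)) λ ()

  End : Set
  End = Dart G ⊎ Fin N

  -- The ends in coordinates.
  toEnd : End → Fin m × End₀
  toEnd (inj₁ d) = proj₁ (cell d) , inj₁ (local d)
  toEnd (inj₂ p) = proj₁ (toPoint p) , inj₂ (proj₂ (toPoint p))

  fromEnd : Fin m × End₀ → End
  fromEnd (j , inj₁ d) = inj₁ (fromCell (j , d))
  fromEnd (j , inj₂ r) = inj₂ (fromPoint (j , r))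

  from-toEnd : ∀ x → fromEnd (toEnd x) ≡ x
  from-toEnd (inj₁ d) = cong inj₁ (fromCell-cell d)
  from-toEnd (inj₂ p) = cong inj₂ (from-toPoint p)

  to-fromEnd : ∀ e → toEnd (fromEnd e) ≡ e
  to-fromEnd (j , inj₁ d) = cong (λ (j , d) → j , inj₁ d) (cell-fromCell (j , d))
  to-fromEnd (j , inj₂ r) = cong (λ (j , r) → j , inj₂ r) (to-fromPoint (j , r))

  module Arc = Cover arc₀ arcVoltage
  module Spin = Cover spin₀ spinVoltage
  module Ψ = Cover ψ₀ ψVoltage

  arc : End → End
  arc x = fromEnd (Arc.lift (toEnd x))

  spin : End → End
  spin = Sum.map σ rotate

  toEnd-arc : ∀ x → toEnd (arc x) ≡ Arc.lift (toEnd x)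
  toEnd-arc x = to-fromEnd _

  arc-fromEnd : ∀ e → arc (fromEnd e) ≡ fromEnd (Arc.lift e)
  arc-fromEnd e = cong (fromEnd ∘ Arc.lift) (to-fromEnd e)

  toEnd-spin : ∀ x → toEnd (spin x) ≡ Spin.lift (toEnd x)
  toEnd-spin (inj₁ d) = cong (λ (j , d) → j , inj₁ d) (cell-σ d)
  toEnd-spin (inj₂ p) = trans (cong (λ (j , r) → j , inj₂ r) (toPoint-rotate p)) (lemma (toPoint p))
    where
    lemma : ∀ (c : Point) → (proj₁ (spinPoint c) , inj₂ (proj₂ (spinPoint c))) ≡ Spin.lift (proj₁ c , inj₂ (proj₂ c))
    lemma (j , 0F) = refl
    lemma (j , 1F) = refl
    lemma (j , 2F) = refl
    lemma (j , 3F) = refl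

  arcOrbits : Orbits arc (m * 14)
  arcOrbits = transfer toEnd fromEnd from-toEnd to-fromEnd toEnd-arc (Arc.orbits arc-orbits λ ())

  spinOrbits : Orbits spin (1 + m * 8)
  spinOrbits = transfer toEnd fromEnd from-toEnd to-fromEnd toEnd-spin
    (Spin.orbits spin-orbits λ { 0F → 4 , refl , unit-2 {i} refl })

  -- The regions of the polygon, where ψ₀ is covered.
  regionOrbits : Orbits (spin ∘ arc) (1 + m * 6)
  regionOrbits = transfer toEnd fromEnd from-toEnd to-fromEnd
    (λ x → trans (toEnd-spin (arc x)) (trans (cong Spin.lift (toEnd-arc x))
      (cong (_, ψ₀ (proj₂ (toEnd x))) (⊕-+ (proj₁ (toEnd x)) (arcVoltage (proj₂ (toEnd x))) (spinVoltage (arc₀ (proj₂ (toEnd x))))))))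
    (Ψ.orbits ψ-orbits λ { 0F → 4 , refl , unit-2 {i} refl })

  module Planar = Connectivity spinOrbits arcOrbits

  at-vertex : ∀ j x k k′ → Star Planar.Step (fromEnd (j , inj₁ (x , k))) (fromEnd (j , inj₁ (x , k′)))
  at-vertex j x k k′ = Planar.along-σ (trans (cong label (to-fromEnd (j , inj₁ (x , k)))) (sym (cong label (to-fromEnd (j , inj₁ (x , k′))))))
    where open Spin.Label spin-orbits

  by-arc : ∀ e → Planar.Step (fromEnd e) (fromEnd (Arc.lift e))
  by-arc e = inj₂ (sym (arc-fromEnd e))

  near-point : ∀ j x k → Near x → ∃ λ p → Star Planar.Step (fromEnd (j , inj₁ (x , k))) (inj₂ p)
  near-point j x k (k′ , r , e) = fromPoint (j ⊕ voltage (x , k′) , r) ,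
    (at-vertex j x k k′ ◅◅ subst (λ e → Planar.Step (fromEnd (j , inj₁ (x , k′))) (fromEnd (j ⊕ voltage (x , k′) , e))) e
      (by-arc (j , inj₁ (x , k′))) ◅ ε)

  -- Every end is connected to the boundary.
  to-point : ∀ e → ∃ λ p → Star Planar.Step (fromEnd e) (inj₂ p)
  to-point (j , inj₂ r) = fromPoint (j , r) , ε
  to-point (j , inj₁ (x , k)) with near-points x
  ... | inj₁ n = near-point j x k n
  ... | inj₂ (k′ , e , n) = let p , star = near-point (j ⊕ voltage (x , k′)) (target x k′) (reverse k′) n in
    p , (at-vertex j x k k′ ◅◅ subst (λ e → Planar.Step (fromEnd (j , inj₁ (x , k′))) (fromEnd (j ⊕ voltage (x , k′) , e))) e
      (by-arc (j , inj₁ (x , k′))) ◅ star)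

  planar-connected : ∀ x y → Star Planar.Step x y
  planar-connected x y with to-point (toEnd x) | to-point (toEnd y)
  ... | p , s | q , s′ = subst (λ x → Star Planar.Step x (inj₂ p)) (from-toEnd x) s ◅◅
    (Planar.along-σ {inj₂ p} {inj₂ q} refl ◅◅ Planar.star-sym (subst (λ y → Star Planar.Step y (inj₂ q)) (from-toEnd y) s′))

  planar : OfGenus spin arc 0
  planar = record
    { #vertices = 1 + m * 8 ; #edges = m * 14 ; #faces = 1 + m * 6
    ; vertices = spinOrbits ; edges = arcOrbits ; faces = regionOrbits
    ; connected = planar-connected
    ; euler = lemma m }
    where
    lemma : ∀ m → 1 + m * 8 + (1 + m * 6) + 2 * 0 ≡ m * 14 + 2
    lemma = solve-∀

  arc-involutive : ∀ x → arc (arc x) ≡ x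
  arc-involutive x = trans (arc-fromEnd (Arc.lift (toEnd x))) (trans (cong fromEnd (twice (toEnd x))) (from-toEnd x))
    where
    twice : ∀ e → Arc.lift (Arc.lift e) ≡ e
    twice (j , e) = cong₂ _,_ (trans (⊕-+ j (arcVoltage e) (arcVoltage (arc₀ e)))
      (trans (cong (j ⊕_) (arcVoltage-arc₀ e)) (⊕-0 j))) (arc₀-involutive e)

  infix 4 _⇝_
  _⇝_ : End → Dart G → Set
  _⇝_ = Reaches glue arc

  arc-dart : ∀ c → arc (inj₁ (fromCell c)) ≡ fromEnd (Arc.lift (proj₁ c , inj₁ (proj₂ c)))
  arc-dart c = arc-fromEnd (proj₁ c , inj₁ (proj₂ c))

  point-⇝ : ∀ j r {b} → arc₀ (inj₂ r) ≡ inj₁ b → ∀ p → toPoint p ≡ (j , r) → inj₂ p ⇝ fromCell (j , b)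
  point-⇝ j r {b} e p e′ = arrive (trans (cong (fromEnd ∘ Arc.lift) (cong (λ (j , r) → j , inj₂ r) e′))
    (trans (cong (λ e → fromEnd (j ⊕ + 0 , e)) e) (cong (λ j → inj₁ (fromCell (j , b))) (⊕-0 j))))

  edge-⇝ : ∀ j b → inj₁ (fromCell (j , b)) ⇝ fromCell (Opp.lift (j , b))
  edge-⇝ j b with arc₀-opp₀ b
  ... | inj₁ e = arrive (trans (arc-dart (j , b)) (cong (λ e → fromEnd (j ⊕ voltage b , e)) e))
  ... | inj₂ (r , e , e′) = cross {p = fromPoint (j ⊕ voltage b , r)}
    (trans (arc-dart (j , b)) (cong (λ e → fromEnd (j ⊕ voltage b , e)) e))
    (point-⇝ (j ⊕ voltage b) (mirror r) e′ (glue (fromPoint (j ⊕ voltage b , r)))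
      (trans (toPoint-glue (fromPoint (j ⊕ voltage b , r)))
        (cong (λ (j , r) → j , mirror r) (to-fromPoint (j ⊕ voltage b , r)))))

  cutout : Cutout m M
  cutout = record
    { genus≡         = trans (ℕ.n≡⌈n+n/2⌉ i) (cong (λ n → ⌊ suc (i + n) /2⌋) (sym (ℕ.+-identityʳ i)))
    ; boundary       = boundary
    ; arc            = arc
    ; arc-involutive = arc-involutive
    ; arc-no-fix     = λ x e → arc₀-no-fix (proj₂ (toEnd x)) (cong proj₂ (trans (sym (toEnd-arc x)) (cong toEnd e)))
    ; planar         = planar
    ; edges          = by-cells (λ d → inj₁ d ⇝ opp G d) λ c →
        subst (λ d → inj₁ (fromCell c) ⇝ d) (sym (opp-fromCell c)) (edge-⇝ (proj₁ c) (proj₂ c))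
    ; allOnEdge      = λ p → let j , r = toPoint p in
        fromCell (j , cutDart r) , point-⇝ j r (arc₀-cutDart r) p refl
    }

-- The faces of the map

-- The left and the right square of a ladder.
outer : Fin 2 → Fin 3
outer 0F = 0F
outer 1F = 2F

outer-injective : ∀ s s′ → outer s ≡ outer s′ → s ≡ s′
outer-injective = from-yes (every? λ s → every? λ s′ → (outer s Fin.≟ outer s′) →-dec (s Fin.≟ s′))

-- Each outer square has a side on each of the three big faces.
outer-sides : ∀ s c → ∃ λ x → ∃ λ k → cubeFace (x , k) ≡ inj₂ (outer s) × cubeFace (opp₀ (x , k)) ≡ inj₁ c
outer-sides = from-yes (every? λ s → every? λ c → Fin.any? λ x → Fin.any? λ k →
  Sum.≡-dec Fin._≟_ Fin._≟_ (cubeFace (x , k)) (inj₂ (outer s)) ×-dec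
  Sum.≡-dec Fin._≟_ Fin._≟_ (cubeFace (opp₀ (x , k))) (inj₁ c))

module FaceCounts (i : ℕ) (1≤i : 1 ≤ i) where
  open Construction i
  open Embedding i
  open Map M using (Adjacent)

  data FaceView : Face → Set where
    is-big    : ∀ c → FaceView (big c)
    is-square : ∀ j q → FaceView (square j q)

  view : ∀ f → FaceView f
  view f = subst FaceView (Fin.join-splitAt 3 (m * 3) f) (go (splitAt 3 f))
    where
    go : ∀ t → FaceView (join 3 (m * 3) t)
    go (inj₁ c) = is-big c
    go (inj₂ p) = subst (λ p → FaceView (3 ↑ʳ p)) (Fin.combine-remQuot {m} 3 p)
      (is-square (proj₁ (remQuot {m} 3 p)) (proj₂ (remQuot {m} 3 p)))

  big-long : 8 * i + 4 ≢ 4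
  big-long e = ℕ.<-irrefl (sym (ℕ.+-cancelʳ-≡ 4 (8 * i) 0 e)) (ℕ.≤-trans 1≤i (ℕ.m≤n*m i 8))

  square-injective : ∀ {j j′ q q′} → square j q ≡ square j′ q′ → j ≡ j′ × q ≡ q′
  square-injective {j} {j′} {q} {q′} e = Fin.combine-injective j q j′ q′ (Fin.↑ʳ-injective 3 _ _ e)

  big≢square : ∀ c j q → big c ≢ square j q
  big≢square c j q e with trans (sym (Fin.splitAt-↑ˡ 3 c (m * 3))) (cong (splitAt 3) e)
  ... | ()

  big-faces : Enumerates (λ f → len f ≡ 8 * i + 4) big
  big-faces = Fin.↑ˡ-injective (m * 3) _ _ , λ f → mk⇔ (from (view f)) λ { (c , refl) → len-big c }
    where
    from : ∀ {f} → FaceView f → len f ≡ 8 * i + 4 → ∃ λ c → big c ≡ f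
    from (is-big c)      _ = c , refl
    from (is-square j q) e = contradiction (sym e) big-long

  squares : HasSize (λ f → len f ≡ 4) (6 * i + 3)
  squares = subst (HasSize _) (lemma i) (3 ↑ʳ_ , Fin.↑ʳ-injective 3 _ _ , λ f →
      mk⇔ (from (view f)) λ { (p , refl) → refl })
    where
    lemma : ∀ i → suc (2 * i) * 3 ≡ 6 * i + 3
    lemma = solve-∀
    from : ∀ {f} → FaceView f → len f ≡ 4 → ∃ λ p → 3 ↑ʳ p ≡ f
    from (is-big c)      e = contradiction (trans (sym (len-big c)) e) big-long
    from (is-square j q) _ = combine j q , refl

  two-lengths : ∀ f → len f ≡ 8 * i + 4 ⊎ len f ≡ 4
  two-lengths f = from (view f)
    where
    from : ∀ {f} → FaceView f → len f ≡ 8 * i + 4 ⊎ len f ≡ 4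
    from (is-big c)      = inj₁ (len-big c)
    from (is-square j q) = inj₂ refl

  outerSquare : Fin (m * 2) → Face
  outerSquare p = let j , s = remQuot {m} 2 p in square j (outer s)

  outerSquare-combine : ∀ j s → outerSquare (combine j s) ≡ square j (outer s)
  outerSquare-combine j s = cong (λ (j , s) → square j (outer s)) (Fin.remQuot-combine {m} {2} j s)

  -- The squares which are adjacent to all big faces.
  Outer : Pred Face 0ℓ
  Outer f = ∃ λ p → outerSquare p ≡ f

  outerSquare-injective : ∀ {p p′} → outerSquare p ≡ outerSquare p′ → p ≡ p′
  outerSquare-injective {p} {p′} e = begin
    p                     ≡⟨ Fin.combine-remQuot {m} 2 p ⟨
    uncurry combine (at p)    ≡⟨ cong₂ combine (proj₁ equal)
      (outer-injective (proj₂ (at p)) (proj₂ (at p′)) (proj₂ equal)) ⟩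
    uncurry combine (at p′)   ≡⟨ Fin.combine-remQuot {m} 2 p′ ⟩
    p′                    ∎
    where
    at = remQuot {m} 2
    equal = square-injective {proj₁ (at p)} {proj₁ (at p′)} {outer (proj₂ (at p))} {outer (proj₂ (at p′))} e

  outer-size : HasSize Outer (4 * i + 2)
  outer-size = subst (HasSize _) (lemma i) (outerSquare , outerSquare-injective , λ f → mk⇔ id id)
    where
    lemma : ∀ i → suc (2 * i) * 2 ≡ 4 * i + 2
    lemma = solve-∀

  middle∉Outer : ∀ j → square j 1F ∉ Outer
  middle∉Outer j (p , e) = 1≢outer (proj₂ (remQuot {m} 2 p)) (proj₂ (square-injective {proj₁ (remQuot {m} 2 p)} {j} e))
    where
    1≢outer : ∀ s → outer s ≢ 1F
    1≢outer 0F ()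
    1≢outer 1F ()

  outer∈Outer : ∀ j s → square j (outer s) ∈ Outer
  outer∈Outer j s = combine j s , outerSquare-combine j s

  middle : ∀ f → len f ≡ 4 → f ∉ Outer → ∃ λ j → square j 1F ≡ f
  middle f = from (view f)
    where
    from : ∀ {f} → FaceView f → len f ≡ 4 → f ∉ Outer → ∃ λ j → square j 1F ≡ f
    from (is-big c)       e f∉ = contradiction (trans (sym (len-big c)) e) big-long
    from (is-square j 0F) e f∉ = contradiction (outer∈Outer j 0F) f∉
    from (is-square j 1F) e f∉ = j , refl
    from (is-square j 2F) e f∉ = contradiction (outer∈Outer j 1F) f∉

  middle-size : HasSize (λ f → len f ≡ 4 × f ∉ Outer) (2 * i + 1)
  middle-size = subst (HasSize _) (ℕ.+-comm 1 (2 * i)) ((λ j → square j 1F) ,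
    (λ {j} {j′} e → proj₁ (square-injective {j} {j′} {1F} {1F} e)) ,
    λ f → mk⇔ (uncurry (middle f)) λ { (j , refl) → refl , middle∉Outer j })

  face-at-square : ∀ j b {q} → cubeFace b ≡ inj₂ q → face (fromCell (j , b)) ≡ square j q
  face-at-square j b {q} e = trans
    (face-square (fromCell (j , b)) (trans (cong (cubeFace ∘ proj₂) (cell-fromCell (j , b))) e))
    (cong (λ c → square (proj₁ c) q) (cell-fromCell (j , b)))

  face-at-big : ∀ j b {c} → cubeFace b ≡ inj₁ c → face (fromCell (j , b)) ≡ big c
  face-at-big j b e = face-big (fromCell (j , b)) (trans (cong (cubeFace ∘ proj₂) (cell-fromCell (j , b))) e)

  across-big : ∀ j b {c} → cubeFace (opp₀ b) ≡ inj₁ c → face (opp G (fromCell (j , b))) ≡ big c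
  across-big j b e = trans (cong face (opp-fromCell (j , b))) (face-at-big (j ⊕ voltage b) (opp₀ b) e)

  across-square : ∀ j b {q} → voltage b ≡ + 0 → cubeFace (opp₀ b) ≡ inj₂ q → face (opp G (fromCell (j , b))) ≡ square j q
  across-square j b {q} v e = trans (cong face (opp-fromCell (j , b)))
    (trans (face-at-square (j ⊕ voltage b) (opp₀ b) e)
      (cong (λ j → square j q) (trans (cong (j ⊕_) v) (⊕-0 j))))

  outer-adjacent : ∀ {f} → f ∈ Outer → ∀ c → Adjacent f (big c)
  outer-adjacent (p , refl) c =
    let j , s = remQuot {m} 2 p; x , k , e , e′ = outer-sides s c in
    (λ eq → big≢square c j (outer s) (sym eq)) ,
    fromCell (j , x , k) , face-at-square j (x , k) e , across-big j (x , k) e′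

  walk : ∀ j b n → Φ.volt b n ≡ + 0 → iterate φ (fromCell (j , b)) n ≡ fromCell (j , iterate φ₀ b n)
  walk j b n v = cell-injective (begin
    cell (iterate φ (fromCell (j , b)) n)       ≡⟨ iterate-semiconj cell cell-φ (fromCell (j , b)) n ⟩
    iterate Φ.lift (cell (fromCell (j , b))) n  ≡⟨ cong (λ c → iterate Φ.lift c n) (cell-fromCell (j , b)) ⟩
    iterate Φ.lift (j , b) n                    ≡⟨ Φ.iterate-lift j b n ⟩
    (j ⊕ Φ.volt b n , iterate φ₀ b n)           ≡⟨ cong (_, iterate φ₀ b n) (trans (cong (j ⊕_) v) (⊕-0 j)) ⟩
    (j , iterate φ₀ b n)                        ≡⟨ cell-fromCell (j , iterate φ₀ b n) ⟨
    cell (fromCell (j , iterate φ₀ b n))        ∎)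

  -- The dart from t₁ to t₂ has the middle square on its right, and the walk around it
  -- passes the right square, b and the left square on its other sides.
  middle-neighbours : ∀ j → ∃ λ d → face d ≡ square j 1F ×
    face (opp G d) ≡ big 1F ×
    face (opp G (iterate φ d 2)) ≡ big 2F ×
    face (opp G (iterate φ d 1)) ∈ Outer ×
    face (opp G (iterate φ d 3)) ∈ Outer ×
    face (opp G (iterate φ d 1)) ≢ face (opp G (iterate φ d 3))
  middle-neighbours j = d , face-at-square j b refl , across-big j b refl ,
      trans (cong (face ∘ opp G) (walk j b 2 refl)) (across-big j (5F , 0F) refl) ,
      subst Outer (sym right) (outer∈Outer j 1F) ,
      subst Outer (sym left) (outer∈Outer j 0F) ,
      λ eq → 2≢0 (proj₂ (square-injective {j} {j} (trans (sym right) (trans eq left))))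
    where
    b = 1F , 0F
    d = fromCell (j , b)
    right : face (opp G (iterate φ d 1)) ≡ square j 2F
    right = trans (cong (face ∘ opp G) (walk j b 1 refl)) (across-square j (2F , 2F) refl refl)
    left : face (opp G (iterate φ d 3)) ≡ square j 0F
    left = trans (cong (face ∘ opp G) (walk j b 3 refl)) (across-square j (6F , 2F) refl refl)
    2≢0 : _≢_ {A = Fin 3} 2F 0F
    2≢0 ()

theorem58 : ∀ (i : ℕ) → 1 ≤ i →
    ∃ λ n → Σ (Graph n) λ G →
    IsConnected G × IsCubic G × HasGirth G 4 × IsGenus G i ×
    Σ (Map G) λ M → let open Map M in
    IsΠMap M ×
    (Σ (Coloring G) λ μ′ → IsETGC G μ′ × IsPeriodic M μ′ ×
    Σ (Face → Permutation′ 3) λ μ → IsAssociatedPFC M μ′ μ) ×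
    Cutout (2 * i + 1) M ×
    Σ (Fin 3 → Face) λ F →
    Enumerates (λ f → len f ≡ 8 * i + 4) F ×
    HasSize (λ f → len f ≡ 4) (6 * i + 3) ×
    (∀ f → len f ≡ 8 * i + 4 ⊎ len f ≡ 4) ×
    Σ (Pred Face 0ℓ) λ S →
    S ⊆ (λ f → len f ≡ 4) ×
    HasSize S (4 * i + 2) ×
    (∀ {f} → f ∈ S → ∀ k → Adjacent f (F k)) ×
    HasSize (λ f → len f ≡ 4 × f ∉ S) (2 * i + 1) ×
    (∀ f → len f ≡ 4 → f ∉ S →
    ∃ λ d → face d ≡ f ×
    face (opp G d) ≡ F 1F ×
    face (opp G (iterate φ d 2)) ≡ F 2F ×
    face (opp G (iterate φ d 1)) ∈ S ×
    face (opp G (iterate φ d 3)) ∈ S ×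
    face (opp G (iterate φ d 1)) ≢ face (opp G (iterate φ d 3)))
theorem58 i 1≤i =
  m * 8 , G , isConnected , isCubic , hasGirth , isGenus , M , isΠMap ,
  (colouring , isETGC , isPeriodic , pfc , isAssociated) ,
  subst (λ n → Cutout n M) (ℕ.+-comm 1 (2 * i)) cutout ,
  big , big-faces , squares , two-lengths ,
  Outer , (λ { (p , refl) → refl }) , outer-size , outer-adjacent , middle-size ,
  λ f e f∉ → let j , f≡ = middle f e f∉ in
    subst (λ f → ∃ λ d → face d ≡ f × _) f≡ (middle-neighbours j)
  where
  open Construction i using (m; G)
  open Embedding i using (M; isConnected; isCubic; isGenus; big; face)
  open Colouring i
  open Cutting i using (cutout)
  open FaceCounts i 1≤i
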